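{- For every integer $n\geq 8$ there exists an almost 2-perfect (A2P) maximum 8-cycle packing of $K_n$.
   Context: An 8-cycle packing of $K_n$ on an $n$-element vertex set $\mathcal{X}$ is a triple $(\mathcal{X},\mathcal{C},\mathcal{L})$ where $\mathcal{C}$ is a collection of pairwise edge-disjoint 8-cycles of $K_n$ and the leave $\mathcal{L}$ is the set of edges of $K_n$ lying in no cycle of $\mathcal{C}$. It is a maximum packing if $|\mathcal{L}|$ is as small as possible among all 8-cycle packings of $K_n$. For an 8-cycle $C$, an inside 8-cycle of $C$ is an 8-cycle on the same vertex set as $C$ sharing no edge with $C$. The packing $(\mathcal{X},\mathcal{C},\mathcal{L})$ is almost 2-perfect (A2P) if one can choose, for each $C\in\mathcal{C}$, an inside 8-cycle $C'$ of $C$ such that the chosen cycles $\mathcal{C}'=\{C'\}$ are pairwise edge-disjoint and contain no edge of $\mathcal{L}$, i.e. $(\mathcal{X},\mathcal{C}',\mathcal{L})$ is again an 8-cycle packing of $K_n$ with the same leave. -}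

module Defs where

open import Data.Fin using (Fin; toℕ; _<_)
open import Data.List using (List; length)
open import Data.List.Membership.Propositional using (_∈_)
open import Data.List.Relation.Binary.Pointwise using (Pointwise)
open import Data.List.Relation.Unary.AllPairs using (AllPairs)
open import Data.List.Relation.Unary.Any using (Any)
open import Data.List.Relation.Unary.Unique.Propositional using (Unique)
open import Data.Nat using (ℕ; suc; _≤_)
open import Data.Nat.DivMod using (_mod_)
open import Data.Product using (Σ; ∃; _×_)
open import Data.Sum using (_⊎_)
open import Function.Bundles using (_⇔_)
open import Function.Definitions using (Injective)
open import Relation.Binary.PropositionalEquality using (_≡_)
open import Relation.Nullary using (¬_)

-- An edge {lo , hi} of the complete graph K_n on the vertex set Fin n.  An
-- unordered pair of distinct vertices is represented by its increasing listing;
-- the irrelevant proof makes edges with equal endpoints equal.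
record Edge (n : ℕ) : Set where
  constructor edge
  field
    lo hi  : Fin n
    .lo<hi : lo < hi

next : Fin 8 → Fin 8
next i = suc (toℕ i) mod 8

-- An 8-cycle (vertex 0 , … , vertex 7).  Rotations and reflections of the same
-- cycle are different elements of this type, so cycles are only ever compared
-- through _∈V_ and _∈E_ below.
record Cycle₈ (n : ℕ) : Set where
  field
    vertex    : Fin 8 → Fin n
    injective : Injective _≡_ _≡_ vertex

module _ {n : ℕ} where

  open Edge
  open Cycle₈

  _∈V_ : Fin n → Cycle₈ n → Set
  v ∈V C = ∃ λ i → v ≡ vertex C i

  _∈E_ : Edge n → Cycle₈ n → Set
  e ∈E C = ∃ λ i →
    (lo e ≡ vertex C i × hi e ≡ vertex C (next i)) ⊎
    (lo e ≡ vertex C (next i) × hi e ≡ vertex C i)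

  EdgeDisjoint : Cycle₈ n → Cycle₈ n → Set
  EdgeDisjoint C D = ∀ e → ¬ (e ∈E C × e ∈E D)

  _Inside_ : Cycle₈ n → Cycle₈ n → Set
  D Inside C = (∀ v → v ∈V D ⇔ v ∈V C) × EdgeDisjoint D C

  -- The finite edge set ℒ is a duplicate-free list, so that length ℒ = |ℒ|.
  -- Pairwise edge-disjointness rules out repetitions in 𝒞, even up to rotation
  -- and reflection, so the list 𝒞 is a set of cycles.
  record IsPacking (𝒞 : List (Cycle₈ n)) (ℒ : List (Edge n)) : Set where
    field
      edge-disjoint : AllPairs EdgeDisjoint 𝒞
      leave-unique  : Unique ℒ
      leave-edges   : ∀ e → e ∈ ℒ ⇔ (¬ Any (e ∈E_) 𝒞)

record Packing (n : ℕ) : Set where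
  field
    cycles    : List (Cycle₈ n)
    leave     : List (Edge n)
    isPacking : IsPacking cycles leave

open Packing

IsMaximum : ∀ {n} → Packing n → Set
IsMaximum {n} P = (Q : Packing n) → length (leave P) ≤ length (leave Q)

-- Pointwise matches the i-th chosen cycle with the i-th cycle of P; the chosen
-- cycles must form a packing with the very same leave as P.
AlmostTwoPerfect : ∀ {n} → Packing n → Set
AlmostTwoPerfect {n} P = Σ (List (Cycle₈ n)) λ 𝒞′ →
  Pointwise _Inside_ 𝒞′ (cycles P) × IsPacking 𝒞′ (leave P)

{-# OPTIONS --safe #-}
-- Swapping the two cycles of a Hamiltonian decomposition of K₄,₄ shows that K₄,₄ is almost
-- 2-perfect, and so is K₆,₄.  Hence every K_{2p,4t} with p ≥ 2 is, and a packing of K_m can be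
-- glued to one of K_{r+4t} along r ≤ 1 common points whenever m − r ≥ 4 is even: the leaves add
-- up.  Adding K₁₆ (leave: a 1-factor) for even m and K₁₇ (empty leave) for odd m reduces the
-- existence part to 8 ≤ n ≤ 23.  The remaining orders are assembled from a few small pieces.
-- For example, two copies of K₉ minus a 4-cycle which share a point off the 4-cycles give K₁₇,
-- because the two 4-cycles together with the K₄,₄ between them form K₈ minus a 1-factor.
--
-- Conversely, the leave has n(n−1)/2 edges modulo 8, and the degrees in it have the parity of
-- n − 1.  So it has at least n/2 edges if n is even, and it cannot have 1 or 2 edges if n is odd.

module Submission where

open import Data.Bool using (if_then_else_)
open import Data.Empty using (⊥; ⊥-elim)
open import Data.Fin using (Fin; toℕ; fromℕ<)
open import Data.Fin.Patterns using (0F; 1F; 2F; 3F; 4F; 5F; 6F; 7F)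
open import Data.Fin.Properties using (all?; any?; toℕ-injective; toℕ-fromℕ<; toℕ<n) renaming (_≟_ to _≟ᶠ_)
open import Data.List using (List; []; _∷_; _++_; map; concatMap; length; tabulate; iterate; downFrom; applyUpTo)
open import Data.List.Membership.Propositional using (_∈_; _∉_; lose; find)
open import Data.List.Membership.Propositional.Properties using (∈-++⁺ˡ; ∈-++⁺ʳ; ∈-++⁻; ∈-map⁺; ∈-map⁻; ∈-concatMap⁺; ∈-concatMap⁻; ∈-tabulate⁺; ∈-tabulate⁻; ∈-downFrom⁺; ∈-downFrom⁻)
open import Data.List.Membership.Propositional.Properties.WithK using (unique∧set⇒bag)
open import Data.List.Properties using (length-++; length-map; length-downFrom; map-++; map-cong; map-tabulate; tabulate-cong; map-concatMap; concatMap-++; concatMap-map; concatMap-cong)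
open import Data.List.Relation.Binary.BagAndSetEquality using (∼bag⇒↭)
open import Data.List.Relation.Binary.Disjoint.Propositional using (Disjoint)
open import Data.List.Relation.Binary.Permutation.Propositional using (_↭_)
open import Data.List.Relation.Binary.Permutation.Propositional.Properties using (↭-length) renaming (map⁺ to ↭-map⁺)
open import Data.List.Relation.Binary.Pointwise using (Pointwise; []; _∷_)
open import Data.List.Relation.Unary.All as All using (All; []; _∷_)
import Data.List.Relation.Unary.All.Properties as All
open import Data.List.Relation.Unary.AllPairs as AllPairs using (AllPairs; []; _∷_)
import Data.List.Relation.Unary.AllPairs.Properties as AllPairs
open import Data.List.Relation.Unary.Any as Any using (Any)
open import Data.List.Relation.Unary.Unique.Propositional using (Unique)
import Data.List.Relation.Unary.Unique.Propositional.Properties as Unique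
open import Data.Nat using (ℕ; zero; suc; _+_; _*_; _∸_; _≤_; _<_; _⊓_; _⊔_; s≤s; z≤n; _<?_; _≤?_)
open import Data.Nat.DivMod using (_%_; _/_; m≡m%n+[m/n]*n; m%n<n)
open import Data.Nat.Divisibility using (>⇒∤; m∣m*n; ∣m+n∣m⇒∣n; divides)
open import Data.Nat.ListAction using (sum)
open import Data.Nat.ListAction.Properties using (sum-++; sum-↭)
open import Data.Nat.Properties
open import Data.Nat.Tactic.RingSolver using (solve-∀)
open import Data.Product as Product using (Σ; ∃; _×_; _,_; proj₁; proj₂; Σ-syntax; ∃-syntax)
open import Data.Product.Properties using (≡-dec; ,-injective)
open import Data.Sum as Sum using (_⊎_; inj₁; inj₂; [_,_]′)
open import Data.Vec using (Vec; []; _∷_; lookup)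
open import Function using (_∘_; id)
open import Function.Bundles using (mk⇔; Equivalence)
open import Function.Definitions using (Injective)
open import Level using (0ℓ)
open import Relation.Binary.Definitions using (tri<; tri≈; tri>)
open import Relation.Binary.PropositionalEquality
open import Relation.Nullary using (¬_; Dec; yes; no; does)
open import Relation.Nullary.Decidable using (True; toWitness; recompute; map′; dec-true; dec-false; ¬?; _×-dec_; _⊎-dec_; _→-dec_)
open import Relation.Unary using (Pred; Decidable; _∪_; _⊆_; _≐_)
open import Defs

-- Circuits, blocks and decompositions over the natural numbers

-- An edge is listed with its smaller end first; this is why relabellings below are
-- required to be increasing.

Pair : Set
Pair = ℕ × ℕ

unordered : ℕ → ℕ → Pair
unordered x y = x ⊓ y , x ⊔ y

Circuit : Set
Circuit = Fin 8 → ℕ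

edgeAt : Circuit → Fin 8 → Pair
edgeAt c i = unordered (c i) (c (next i))

circuitEdges : Circuit → List Pair
circuitEdges c = tabulate (edgeAt c)

-- Pairs a cycle of the packing with its chosen inside cycle, so that the two packings are always
-- built in parallel.
record Block : Set where
  constructor block
  field
    outer inner : Circuit

open Block

record IsInside (d c : Circuit) : Set where
  field
    d-injective : Injective _≡_ _≡_ d
    c-injective : Injective _≡_ _≡_ c
    d⊆c         : ∀ i → ∃ λ j → d i ≡ c j
    c⊆d         : ∀ i → ∃ λ j → c i ≡ d j
    disjoint    : Disjoint (circuitEdges d) (circuitEdges c)

Valid : Block → Set
Valid b = IsInside (inner b) (outer b)

outerEdges innerEdges : List Block → List Pair
outerEdges = concatMap (circuitEdges ∘ outer)
innerEdges = concatMap (circuitEdges ∘ inner)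

-- In use, `es` concatenates the edge lists of the cycles, so `es-unique` also says that different
-- cycles are edge-disjoint.
record Splits (E : Pred Pair 0ℓ) (ls es : List Pair) : Set where
  field
    ls-unique : Unique ls
    es-unique : Unique es
    separate  : Disjoint ls es
    ls-sound  : ∀ {e} → e ∈ ls → E e
    es-sound  : ∀ {e} → e ∈ es → E e
    complete  : ∀ {e} → E e → e ∈ ls ⊎ e ∈ es

-- An almost 2-perfect packing of the graph `E`: the outer and the inner cycles split `E` with one
-- and the same `leave`.
record Decomposition (E : Pred Pair 0ℓ) (ℓ : ℕ) : Set where
  field
    blocks       : List Block
    leave        : List Pair
    valid        : All Valid blocks
    leave-size   : length leave ≡ ℓ
    outer-splits : Splits E leave (outerEdges blocks)
    inner-splits : Splits E leave (innerEdges blocks)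

open Splits
open Decomposition

-- Operations on decompositions

Splits-resp-≐ : ∀ {E F ls es} → E ≐ F → Splits E ls es → Splits F ls es
Splits-resp-≐ (E⊆F , F⊆E) s = record
  { ls-unique = ls-unique s
  ; es-unique = es-unique s
  ; separate  = separate s
  ; ls-sound  = E⊆F ∘ ls-sound s
  ; es-sound  = E⊆F ∘ es-sound s
  ; complete  = complete s ∘ F⊆E
  }

resp-≐ : ∀ {E F ℓ} → E ≐ F → Decomposition E ℓ → Decomposition F ℓ
resp-≐ E≐F D = record
  { blocks       = blocks D
  ; leave        = leave D
  ; valid        = valid D
  ; leave-size   = leave-size D
  ; outer-splits = Splits-resp-≐ E≐F (outer-splits D)
  ; inner-splits = Splits-resp-≐ E≐F (inner-splits D)
  }

module _ {E F : Pred Pair 0ℓ} (E∩F : ∀ {e} → E e → F e → ⊥) where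

  Splits-∪ : ∀ {ls es ls′ es′} → Splits E ls es → Splits F ls′ es′ →
             Splits (E ∪ F) (ls ++ ls′) (es ++ es′)
  Splits-∪ {ls} {es} {ls′} {es′} s t = record
    { ls-unique = Unique.++⁺ (ls-unique s) (ls-unique t)
                    (λ (p , q) → E∩F (ls-sound s p) (ls-sound t q))
    ; es-unique = Unique.++⁺ (es-unique s) (es-unique t)
                    (λ (p , q) → E∩F (es-sound s p) (es-sound t q))
    ; separate  = λ (p , q) → sep (∈-++⁻ ls p) (∈-++⁻ es q)
    ; ls-sound  = Sum.map (ls-sound s) (ls-sound t) ∘ ∈-++⁻ ls
    ; es-sound  = Sum.map (es-sound s) (es-sound t) ∘ ∈-++⁻ es
    ; complete  = [ Sum.map ∈-++⁺ˡ ∈-++⁺ˡ ∘ complete s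
                  , Sum.map (∈-++⁺ʳ ls) (∈-++⁺ʳ es) ∘ complete t ]′
    }
    where
    sep : ∀ {e} → e ∈ ls ⊎ e ∈ ls′ → e ∈ es ⊎ e ∈ es′ → ⊥
    sep (inj₁ p) (inj₁ q) = separate s (p , q)
    sep (inj₁ p) (inj₂ q) = E∩F (ls-sound s p) (es-sound t q)
    sep (inj₂ p) (inj₁ q) = E∩F (es-sound s q) (ls-sound t p)
    sep (inj₂ p) (inj₂ q) = separate t (p , q)

  union : ∀ {ℓ ℓ′} → Decomposition E ℓ → Decomposition F ℓ′ → Decomposition (E ∪ F) (ℓ + ℓ′)
  union D D′ = record
    { blocks       = blocks D ++ blocks D′
    ; leave        = leave D ++ leave D′
    ; valid        = All.++⁺ (valid D) (valid D′)
    ; leave-size   = trans (length-++ (leave D)) (cong₂ _+_ (leave-size D) (leave-size D′))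
    ; outer-splits = subst (Splits _ _) (sym (concatMap-++ _ (blocks D) (blocks D′)))
                       (Splits-∪ (outer-splits D) (outer-splits D′))
    ; inner-splits = subst (Splits _ _) (sym (concatMap-++ _ (blocks D) (blocks D′)))
                       (Splits-∪ (inner-splits D) (inner-splits D′))
    }

relabelBlock : (ℕ → ℕ) → Block → Block
relabelBlock f (block c d) = block (f ∘ c) (f ∘ d)

both : (ℕ → ℕ) → Pair → Pair
both f = Product.map f f

Image : (ℕ → ℕ) → Pred Pair 0ℓ → Pred Pair 0ℓ
Image f E e = ∃ λ e′ → E e′ × e ≡ both f e′

module Relabelling {f : ℕ → ℕ} (mono : ∀ {x y} → x < y → f x < f y) where

  f-injective : Injective _≡_ _≡_ f
  f-injective {x} {y} eq with <-cmp x y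
  ... | tri< x<y _ _ = ⊥-elim (<-irrefl eq (mono x<y))
  ... | tri≈ _ x≡y _ = x≡y
  ... | tri> _ _ y<x = ⊥-elim (<-irrefl (sym eq) (mono y<x))

  both-injective : Injective _≡_ _≡_ (both f)
  both-injective eq with eq₁ , eq₂ ← ,-injective eq = cong₂ _,_ (f-injective eq₁) (f-injective eq₂)

  mono-≤ : ∀ {x y} → x ≤ y → f x ≤ f y
  mono-≤ x≤y with m≤n⇒m<n∨m≡n x≤y
  ... | inj₁ x<y  = <⇒≤ (mono x<y)
  ... | inj₂ refl = ≤-refl

  -- An increasing map commutes with minimum and maximum, so relabelled edges stay sorted.
  circuitEdges-relabel : ∀ c → circuitEdges (f ∘ c) ≡ map (both f) (circuitEdges c)
  circuitEdges-relabel c = trans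
    (tabulate-cong λ i → cong₂ _,_
      (sym (mono-≤-distrib-⊓ mono-≤ (c i) (c (next i))))
      (sym (mono-≤-distrib-⊔ mono-≤ (c i) (c (next i)))))
    (sym (map-tabulate (edgeAt c) (both f)))

  concatMap-relabel : (side : Block → Circuit) →
    (∀ b → circuitEdges (side (relabelBlock f b)) ≡ map (both f) (circuitEdges (side b))) →
    ∀ bs → concatMap (circuitEdges ∘ side) (map (relabelBlock f) bs)
         ≡ map (both f) (concatMap (circuitEdges ∘ side) bs)
  concatMap-relabel side eq bs = begin
    concatMap (circuitEdges ∘ side) (map (relabelBlock f) bs)
      ≡⟨ concatMap-map _ (relabelBlock f) bs ⟩
    concatMap (circuitEdges ∘ side ∘ relabelBlock f) bs
      ≡⟨ concatMap-cong eq bs ⟩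
    concatMap (map (both f) ∘ circuitEdges ∘ side) bs
      ≡⟨ sym (map-concatMap (both f) _ bs) ⟩
    map (both f) (concatMap (circuitEdges ∘ side) bs) ∎
    where open ≡-Reasoning

  disjoint-map : ∀ {xs ys} → Disjoint xs ys → Disjoint (map (both f) xs) (map (both f) ys)
  disjoint-map {xs} {ys} dis (p , q)
    with x , x∈xs , refl ← ∈-map⁻ (both f) p
       | y , y∈ys , eq   ← ∈-map⁻ (both f) q
    with refl ← both-injective eq = dis (x∈xs , y∈ys)

  Splits-relabel : ∀ {E ls es} → Splits E ls es →
                   Splits (Image f E) (map (both f) ls) (map (both f) es)
  Splits-relabel s = record
    { ls-unique = Unique.map⁺ both-injective (ls-unique s)
    ; es-unique = Unique.map⁺ both-injective (es-unique s)
    ; separate  = disjoint-map (separate s)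
    ; ls-sound  = λ p → let x , x∈ , eq = ∈-map⁻ (both f) p in x , ls-sound s x∈ , eq
    ; es-sound  = λ p → let x , x∈ , eq = ∈-map⁻ (both f) p in x , es-sound s x∈ , eq
    ; complete  = λ { (_ , Ee , refl) → Sum.map (∈-map⁺ (both f)) (∈-map⁺ (both f)) (complete s Ee) }
    }

  Valid-relabel : ∀ {b} → Valid b → Valid (relabelBlock f b)
  Valid-relabel {block c d} v = record
    { d-injective = d-injective ∘ f-injective
    ; c-injective = c-injective ∘ f-injective
    ; d⊆c         = Product.map id (cong f) ∘ d⊆c
    ; c⊆d         = Product.map id (cong f) ∘ c⊆d
    ; disjoint    = subst₂ Disjoint (sym (circuitEdges-relabel d)) (sym (circuitEdges-relabel c))
                      (disjoint-map disjoint)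
    }
    where open IsInside v

  relabel : ∀ {E ℓ} → Decomposition E ℓ → Decomposition (Image f E) ℓ
  relabel D = record
    { blocks       = map (relabelBlock f) (blocks D)
    ; leave        = map (both f) (leave D)
    ; valid        = All.map⁺ (All.map Valid-relabel (valid D))
    ; leave-size   = trans (length-map _ (leave D)) (leave-size D)
    ; outer-splits = subst (Splits _ _)
        (sym (concatMap-relabel outer (circuitEdges-relabel ∘ outer) (blocks D)))
        (Splits-relabel (outer-splits D))
    ; inner-splits = subst (Splits _ _)
        (sym (concatMap-relabel inner (circuitEdges-relabel ∘ inner) (blocks D)))
        (Splits-relabel (inner-splits D))
    }

open Relabelling using (relabel)

-- Complete and complete bipartite graphs

K : ℕ → Pred Pair 0ℓ
K n (x , y) = x < y × y < n

-- The complete bipartite graph between two intervals. It is decomposed only for `a + k ≤ b`,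
-- because the smaller end of a pair comes first.
Join : (a k b l : ℕ) → Pred Pair 0ℓ
Join a k b l (x , y) = (a ≤ x × x < a + k) × (b ≤ y × y < b + l)

K? : ∀ n → Decidable (K n)
K? n (x , y) = (x <? y) ×-dec (y <? n)

Join? : ∀ a k b l → Decidable (Join a k b l)
Join? a k b l (x , y) = ((a ≤? x) ×-dec (x <? a + k)) ×-dec ((b ≤? y) ×-dec (y <? b + l))

pairs : ℕ → List Pair
pairs zero    = []
pairs (suc n) = map (_, n) (downFrom n) ++ pairs n

∈-pairs⁺ : ∀ {n e} → K n e → e ∈ pairs n
∈-pairs⁺ {suc n} {x , y} (x<y , s≤s y≤n) with m≤n⇒m<n∨m≡n y≤n
... | inj₁ y<n  = ∈-++⁺ʳ (map (_, n) (downFrom n)) (∈-pairs⁺ (x<y , y<n))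
... | inj₂ refl = ∈-++⁺ˡ (∈-map⁺ (_, n) (∈-downFrom⁺ x<y))

-- Small decompositions

_≟ᵖ_ : (e e′ : Pair) → Dec (e ≡ e′)
_≟ᵖ_ = ≡-dec _≟_ _≟_

open import Data.List.Membership.DecPropositional _≟ᵖ_ using (_∈?_; _∉?_)
open import Data.List.Relation.Unary.Unique.DecPropositional _≟ᵖ_ using (unique?)

avoids⇒disjoint : {xs ys : List Pair} → All (_∉ ys) xs → Disjoint xs ys
avoids⇒disjoint h (p , q) = All.lookup h p q

disjoint⇒avoids : {xs ys : List Pair} → Disjoint xs ys → All (_∉ ys) xs
disjoint⇒avoids h = All.tabulate λ p q → h (p , q)

injective? : (c : Circuit) → Dec (∀ i j → c i ≡ c j → i ≡ j)
injective? c = all? λ i → all? λ j → (c i ≟ c j) →-dec (i ≟ᶠ j)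

inside? : ∀ d c → Dec (IsInside d c)
inside? d c = map′
  (λ ((p , q) , (r , s) , t) → record
    { d-injective = p _ _ ; c-injective = q _ _ ; d⊆c = r ; c⊆d = s ; disjoint = avoids⇒disjoint t })
  (λ v → let open IsInside v in
    ((λ i j → d-injective) , (λ i j → c-injective)) , (d⊆c , c⊆d) , disjoint⇒avoids disjoint)
  ((injective? d ×-dec injective? c) ×-dec
   ((all? λ i → any? λ j → d i ≟ c j) ×-dec (all? λ i → any? λ j → c i ≟ d j)) ×-dec
   All.all? (_∉? circuitEdges c) (circuitEdges d))

module _ (n : ℕ) {E : Pred Pair 0ℓ} (E? : Decidable E) (E⊆K : E ⊆ K n) where

  splits? : ∀ ls es → Dec (Splits E ls es)
  splits? ls es = map′
    (λ (((u , v) , w) , (p , q) , r) → record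
      { ls-unique = u ; es-unique = v ; separate = avoids⇒disjoint w
      ; ls-sound = All.lookup p ; es-sound = All.lookup q
      ; complete = λ Ee → All.lookup r (∈-pairs⁺ (E⊆K Ee)) Ee })
    (λ s → ((ls-unique s , es-unique s) , disjoint⇒avoids (separate s)) ,
           (All.tabulate (ls-sound s) , All.tabulate (es-sound s)) ,
           All.tabulate (λ _ → complete s))
    (((unique? ls ×-dec unique? es) ×-dec All.all? (_∉? es) ls) ×-dec
     (All.all? E? ls ×-dec All.all? E? es) ×-dec
     All.all? (λ e → E? e →-dec ((e ∈? ls) ⊎-dec (e ∈? es))) (pairs n))

  -- For a concrete design the implicit arguments are filled in by evaluating the decision
  -- procedures, so the design is checked by computation.
  verified : (bs : List Block) (ls : List Pair) →
    {_ : True (All.all? (λ b → inside? (inner b) (outer b)) bs)} →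
    {_ : True (splits? ls (outerEdges bs))} →
    {_ : True (splits? ls (innerEdges bs))} →
    Decomposition E (length ls)
  verified bs ls {v} {p} {q} = record
    { blocks = bs ; leave = ls ; valid = toWitness v ; leave-size = refl
    ; outer-splits = toWitness p ; inner-splits = toWitness q }

verifiedK : ∀ n (bs : List Block) (ls : List Pair) →
  {_ : True (All.all? (λ b → inside? (inner b) (outer b)) bs)} →
  {_ : True (splits? n (K? n) id ls (outerEdges bs))} →
  {_ : True (splits? n (K? n) id ls (innerEdges bs))} →
  Decomposition (K n) (length ls)
verifiedK n bs ls {v} {p} {q} = verified n (K? n) id bs ls {v} {p} {q}

-- Explicit designs

⟨_∣_⟩ : Vec ℕ 8 → Vec ℕ 8 → Block
⟨ c ∣ d ⟩ = block (lookup c) (lookup d)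

nth : List ℕ → ℕ → ℕ
-- A default that is never reached: each list of labels below covers all vertices of the design it
-- relabels.
nth []       _       = 0
nth (x ∷ _)  zero    = x
nth (_ ∷ xs) (suc i) = nth xs i

-- Unlike in `relabel`, the new labels need not be increasing, since the resulting blocks are
-- verified directly.
_on_ : List Block → List ℕ → List Block
bs on xs = map (relabelBlock (nth xs)) bs

-- Two Hamiltonian cycles that decompose the graph, each serving as the inside cycle of the other.
K₄₄ : List Block
K₄₄ = ⟨ 0 ∷ 4 ∷ 1 ∷ 5 ∷ 2 ∷ 6 ∷ 3 ∷ 7 ∷ [] ∣ 0 ∷ 5 ∷ 3 ∷ 4 ∷ 2 ∷ 7 ∷ 1 ∷ 6 ∷ [] ⟩
    ∷ ⟨ 0 ∷ 5 ∷ 3 ∷ 4 ∷ 2 ∷ 7 ∷ 1 ∷ 6 ∷ [] ∣ 0 ∷ 4 ∷ 1 ∷ 5 ∷ 2 ∷ 6 ∷ 3 ∷ 7 ∷ [] ⟩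
    ∷ []

-- The larger side consists of the pairs 01, 23, 45, and each cycle misses one of these pairs. The
-- involution (0 1)(2 3)(4 5) turns each cycle into its inside cycle.
K₆₄ : List Block
K₆₄ = ⟨ 6 ∷ 0 ∷ 7 ∷ 2 ∷ 8 ∷ 1 ∷ 9 ∷ 3 ∷ [] ∣ 6 ∷ 1 ∷ 7 ∷ 3 ∷ 8 ∷ 0 ∷ 9 ∷ 2 ∷ [] ⟩
    ∷ ⟨ 6 ∷ 1 ∷ 7 ∷ 5 ∷ 9 ∷ 0 ∷ 8 ∷ 4 ∷ [] ∣ 6 ∷ 0 ∷ 7 ∷ 4 ∷ 9 ∷ 1 ∷ 8 ∷ 5 ∷ [] ⟩
    ∷ ⟨ 6 ∷ 2 ∷ 9 ∷ 4 ∷ 7 ∷ 3 ∷ 8 ∷ 5 ∷ [] ∣ 6 ∷ 3 ∷ 9 ∷ 5 ∷ 7 ∷ 2 ∷ 8 ∷ 4 ∷ [] ⟩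
    ∷ []

-- The omitted 1-factor is 01, 23, 45, 67; relabellings choose its image through the order of the
-- list.
K₈∖F : List Block
K₈∖F = ⟨ 0 ∷ 2 ∷ 7 ∷ 4 ∷ 3 ∷ 5 ∷ 1 ∷ 6 ∷ [] ∣ 0 ∷ 3 ∷ 1 ∷ 4 ∷ 2 ∷ 6 ∷ 5 ∷ 7 ∷ [] ⟩
     ∷ ⟨ 0 ∷ 3 ∷ 6 ∷ 2 ∷ 5 ∷ 7 ∷ 1 ∷ 4 ∷ [] ∣ 0 ∷ 5 ∷ 1 ∷ 2 ∷ 7 ∷ 3 ∷ 4 ∷ 6 ∷ [] ⟩
     ∷ ⟨ 0 ∷ 5 ∷ 6 ∷ 4 ∷ 2 ∷ 1 ∷ 3 ∷ 7 ∷ [] ∣ 0 ∷ 2 ∷ 5 ∷ 3 ∷ 6 ∷ 1 ∷ 7 ∷ 4 ∷ [] ⟩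
     ∷ []

-- The omitted 4-cycle is (1 , 2 , 3 , 4).
K₉∖C₄ : List Block
K₉∖C₄ = ⟨ 0 ∷ 3 ∷ 6 ∷ 5 ∷ 8 ∷ 2 ∷ 4 ∷ 7 ∷ [] ∣ 0 ∷ 4 ∷ 8 ∷ 3 ∷ 7 ∷ 6 ∷ 2 ∷ 5 ∷ [] ⟩
      ∷ ⟨ 0 ∷ 4 ∷ 6 ∷ 1 ∷ 8 ∷ 3 ∷ 7 ∷ 5 ∷ [] ∣ 0 ∷ 1 ∷ 3 ∷ 5 ∷ 4 ∷ 7 ∷ 8 ∷ 6 ∷ [] ⟩
      ∷ ⟨ 0 ∷ 1 ∷ 5 ∷ 4 ∷ 8 ∷ 7 ∷ 2 ∷ 6 ∷ [] ∣ 0 ∷ 2 ∷ 4 ∷ 6 ∷ 5 ∷ 7 ∷ 1 ∷ 8 ∷ [] ⟩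
      ∷ ⟨ 0 ∷ 2 ∷ 5 ∷ 3 ∷ 1 ∷ 7 ∷ 6 ∷ 8 ∷ [] ∣ 0 ∷ 3 ∷ 6 ∷ 1 ∷ 5 ∷ 8 ∷ 2 ∷ 7 ∷ [] ⟩
      ∷ []

-- One base block is rotated by the permutation (0 1 2 3 4)(5 6 7 8 9) of order 5. The omitted
-- 1-factor joins `i` to `i + 5`.
K₁₀∖F : List Block
K₁₀∖F = iterate (relabelBlock (nth (1 ∷ 2 ∷ 3 ∷ 4 ∷ 0 ∷ 6 ∷ 7 ∷ 8 ∷ 9 ∷ 5 ∷ [])))
  ⟨ 0 ∷ 1 ∷ 3 ∷ 7 ∷ 9 ∷ 2 ∷ 5 ∷ 6 ∷ [] ∣ 0 ∷ 2 ∷ 3 ∷ 6 ∷ 9 ∷ 5 ∷ 1 ∷ 7 ∷ [] ⟩ 5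

-- The omitted cycles are the triangle (0 , 1 , 2) and the 4-cycle (3 , 4 , 5 , 6).
K₁₁∖C₃C₄ : List Block
K₁₁∖C₃C₄ = ⟨ 0 ∷ 6 ∷ 4 ∷ 1 ∷ 8 ∷ 3 ∷ 10 ∷ 7 ∷ [] ∣ 0 ∷ 3 ∷ 1 ∷ 6 ∷ 7 ∷ 8 ∷ 10 ∷ 4 ∷ [] ⟩
         ∷ ⟨ 1 ∷ 3 ∷ 2 ∷ 9 ∷ 5 ∷ 8 ∷ 7 ∷ 6 ∷ [] ∣ 1 ∷ 5 ∷ 3 ∷ 7 ∷ 2 ∷ 6 ∷ 8 ∷ 9 ∷ [] ⟩
         ∷ ⟨ 0 ∷ 3 ∷ 5 ∷ 2 ∷ 6 ∷ 9 ∷ 4 ∷ 10 ∷ [] ∣ 0 ∷ 5 ∷ 10 ∷ 6 ∷ 4 ∷ 2 ∷ 3 ∷ 9 ∷ [] ⟩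
         ∷ ⟨ 0 ∷ 4 ∷ 7 ∷ 2 ∷ 8 ∷ 10 ∷ 1 ∷ 9 ∷ [] ∣ 0 ∷ 8 ∷ 4 ∷ 1 ∷ 7 ∷ 9 ∷ 2 ∷ 10 ∷ [] ⟩
         ∷ ⟨ 1 ∷ 5 ∷ 10 ∷ 2 ∷ 4 ∷ 8 ∷ 9 ∷ 7 ∷ [] ∣ 1 ∷ 8 ∷ 2 ∷ 5 ∷ 7 ∷ 4 ∷ 9 ∷ 10 ∷ [] ⟩
         ∷ ⟨ 0 ∷ 5 ∷ 7 ∷ 3 ∷ 9 ∷ 10 ∷ 6 ∷ 8 ∷ [] ∣ 0 ∷ 6 ∷ 9 ∷ 5 ∷ 8 ∷ 3 ∷ 10 ∷ 7 ∷ [] ⟩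
         ∷ []

-- The omitted K₅ is on {0 , … , 4} and the omitted 5-cycle is (5 , 6 , 7 , 8 , 9).
K₁₁∖K₅C₅ : List Block
K₁₁∖K₅C₅ = iterate (relabelBlock (nth (1 ∷ 2 ∷ 3 ∷ 4 ∷ 0 ∷ 6 ∷ 7 ∷ 8 ∷ 9 ∷ 5 ∷ 10 ∷ [])))
  ⟨ 0 ∷ 5 ∷ 2 ∷ 6 ∷ 8 ∷ 1 ∷ 7 ∷ 10 ∷ [] ∣ 0 ∷ 7 ∷ 5 ∷ 1 ∷ 6 ∷ 10 ∷ 2 ∷ 8 ∷ [] ⟩ 5

blocks₁₇ : List Block
blocks₁₇ =
  K₉∖C₄ ++
  (K₉∖C₄ on (0 ∷ 9 ∷ 10 ∷ 11 ∷ 12 ∷ 13 ∷ 14 ∷ 15 ∷ 16 ∷ [])) ++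
  -- The omitted 1-factor becomes 13, 24, 9-11, 10-12: the diagonals of the two missing 4-cycles,
  -- which are already covered.
  (K₈∖F on (1 ∷ 3 ∷ 2 ∷ 4 ∷ 9 ∷ 11 ∷ 10 ∷ 12 ∷ [])) ++
  (K₄₄ on (1 ∷ 2 ∷ 3 ∷ 4 ∷ 13 ∷ 14 ∷ 15 ∷ 16 ∷ [])) ++
  (K₄₄ on (5 ∷ 6 ∷ 7 ∷ 8 ∷ 9 ∷ 10 ∷ 11 ∷ 12 ∷ [])) ++
  (K₄₄ on (5 ∷ 6 ∷ 7 ∷ 8 ∷ 13 ∷ 14 ∷ 15 ∷ 16 ∷ []))

decomposition₄₄ : Decomposition (Join 0 4 4 4) 0
decomposition₄₄ = verified 8 (Join? 0 4 4 4)
  (λ ((_ , x<4) , (4≤y , y<8)) → <-≤-trans x<4 4≤y , y<8) K₄₄ []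

decomposition₆₄ : Decomposition (Join 0 6 6 4) 0
decomposition₆₄ = verified 10 (Join? 0 6 6 4)
  (λ ((_ , x<6) , (6≤y , y<10)) → <-≤-trans x<6 6≤y , y<10) K₆₄ []

-- No 8-cycle fits, so all six edges are left. As a filling of four new points this is still good
-- enough for the orders 12, 14, 20 and 22.
decomposition₄ : Decomposition (K 4) 6
decomposition₄ = verifiedK 4 [] (pairs 4)

decomposition₅ : Decomposition (K 5) 10
decomposition₅ = verifiedK 5 [] (pairs 5)

decomposition₈ : Decomposition (K 8) 4
decomposition₈ = verifiedK 8 K₈∖F ((0 , 1) ∷ (2 , 3) ∷ (4 , 5) ∷ (6 , 7) ∷ [])

decomposition₉ : Decomposition (K 9) 4
decomposition₉ = verifiedK 9 K₉∖C₄ ((1 , 2) ∷ (2 , 3) ∷ (3 , 4) ∷ (1 , 4) ∷ [])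

decomposition₁₀ : Decomposition (K 10) 5
decomposition₁₀ = verifiedK 10 K₁₀∖F ((0 , 5) ∷ (1 , 6) ∷ (2 , 7) ∷ (3 , 8) ∷ (4 , 9) ∷ [])

decomposition₁₁ : Decomposition (K 11) 7
decomposition₁₁ = verifiedK 11 K₁₁∖C₃C₄
  ((0 , 1) ∷ (0 , 2) ∷ (1 , 2) ∷ (3 , 4) ∷ (4 , 5) ∷ (5 , 6) ∷ (3 , 6) ∷ [])

decomposition₁₃ : Decomposition (K 13) 6
decomposition₁₃ = verifiedK 13
  (K₉∖C₄ ++
   -- Covers the missing 4-cycle, its join to the four new points, and the `K₄` on these except 9-10
   -- and 11-12. Together with vertex 0 these two edges form the two triangles of the leave.
   (K₈∖F on (1 ∷ 3 ∷ 2 ∷ 4 ∷ 9 ∷ 10 ∷ 11 ∷ 12 ∷ [])) ++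
   (K₄₄ on (5 ∷ 6 ∷ 7 ∷ 8 ∷ 9 ∷ 10 ∷ 11 ∷ 12 ∷ [])))
  ((0 , 9) ∷ (0 , 10) ∷ (9 , 10) ∷ (0 , 11) ∷ (0 , 12) ∷ (11 , 12) ∷ [])

decomposition₁₅ : Decomposition (K 15) 9
decomposition₁₅ = verifiedK 15
  (K₉∖C₄ ++
   -- The hole `K₅` sits on five points of the `K₉`. The six new points are then joined to the other
   -- four points by a `K₆,₄`, and the leave is a 4-cycle and a 5-cycle.
   (K₁₁∖K₅C₅ on (0 ∷ 1 ∷ 2 ∷ 3 ∷ 4 ∷ 9 ∷ 10 ∷ 11 ∷ 12 ∷ 13 ∷ 14 ∷ [])) ++
   (K₆₄ on (9 ∷ 10 ∷ 11 ∷ 12 ∷ 13 ∷ 14 ∷ 5 ∷ 6 ∷ 7 ∷ 8 ∷ [])))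
  ((1 , 2) ∷ (2 , 3) ∷ (3 , 4) ∷ (1 , 4) ∷
   (9 , 10) ∷ (10 , 11) ∷ (11 , 12) ∷ (12 , 13) ∷ (9 , 13) ∷ [])

decomposition₁₇ : Decomposition (K 17) 0
decomposition₁₇ = verifiedK 17 blocks₁₇ []

decomposition₁₉ : Decomposition (K 19) 3
decomposition₁₉ = verifiedK 19
  (K₁₁∖C₃C₄ ++
   -- The two copies share exactly the omitted triangle, which becomes the leave; their 4-cycles are
   -- absorbed as for order 17.
   (K₁₁∖C₃C₄ on (0 ∷ 1 ∷ 2 ∷ 11 ∷ 12 ∷ 13 ∷ 14 ∷ 15 ∷ 16 ∷ 17 ∷ 18 ∷ [])) ++
   (K₈∖F on (3 ∷ 5 ∷ 4 ∷ 6 ∷ 11 ∷ 13 ∷ 12 ∷ 14 ∷ [])) ++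
   (K₄₄ on (3 ∷ 4 ∷ 5 ∷ 6 ∷ 15 ∷ 16 ∷ 17 ∷ 18 ∷ [])) ++
   (K₄₄ on (7 ∷ 8 ∷ 9 ∷ 10 ∷ 11 ∷ 12 ∷ 13 ∷ 14 ∷ [])) ++
   (K₄₄ on (7 ∷ 8 ∷ 9 ∷ 10 ∷ 15 ∷ 16 ∷ 17 ∷ 18 ∷ [])))
  ((0 , 1) ∷ (0 , 2) ∷ (1 , 2) ∷ [])

decomposition₂₃ : Decomposition (K 23) 5
decomposition₂₃ = verifiedK 23
  (blocks₁₇ ++
   -- The hole `K₅` sits on five of the 17 old points; the other twelve are joined to the six new
   -- points in three groups of four.
   (K₁₁∖K₅C₅ on (0 ∷ 1 ∷ 2 ∷ 3 ∷ 4 ∷ 17 ∷ 18 ∷ 19 ∷ 20 ∷ 21 ∷ 22 ∷ [])) ++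
   (K₆₄ on (17 ∷ 18 ∷ 19 ∷ 20 ∷ 21 ∷ 22 ∷ 5 ∷ 6 ∷ 7 ∷ 8 ∷ [])) ++
   (K₆₄ on (17 ∷ 18 ∷ 19 ∷ 20 ∷ 21 ∷ 22 ∷ 9 ∷ 10 ∷ 11 ∷ 12 ∷ [])) ++
   (K₆₄ on (17 ∷ 18 ∷ 19 ∷ 20 ∷ 21 ∷ 22 ∷ 13 ∷ 14 ∷ 15 ∷ 16 ∷ [])))
  ((17 , 18) ∷ (18 , 19) ∷ (19 , 20) ∷ (20 , 21) ∷ (17 , 21) ∷ [])

-- Gluing

empty : ∀ {E} → (∀ {e} → ¬ E e) → Decomposition E 0
empty ¬E = record
  { blocks = [] ; leave = [] ; valid = [] ; leave-size = refl
  ; outer-splits = splits ; inner-splits = splits }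
  where
  splits : Splits _ [] []
  splits = record
    { ls-unique = [] ; es-unique = [] ; separate = λ ()
    ; ls-sound = λ () ; es-sound = λ () ; complete = ⊥-elim ∘ ¬E }

-- Cuts the labels at `k` and moves the two parts to start at `a` and `b`. It is increasing as soon
-- as the first part ends before `b`, and it places both bipartite and complete graphs.
place : (k a b : ℕ) → ℕ → ℕ
place k a b x with x <? k
... | yes _ = a + x
... | no  _ = b + (x ∸ k)

place-< : ∀ {k a b x} → x < k → place k a b x ≡ a + x
place-< {k} {x = x} x<k with x <? k
... | yes _  = refl
... | no x≮k = ⊥-elim (x≮k x<k)

place-≥ : ∀ {k a b x} → k ≤ x → place k a b x ≡ b + (x ∸ k)
place-≥ {k} {x = x} k≤x with x <? k
... | yes x<k = ⊥-elim (<⇒≱ x<k k≤x)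
... | no _    = refl

place-+ : ∀ k {a b} y → place k a b (k + y) ≡ b + y
place-+ k {b = b} y = trans (place-≥ (m≤m+n k y)) (cong (b +_) (m+n∸m≡n k y))

place-mono : ∀ k a {b} → a + k ≤ b → ∀ {x y} → x < y → place k a b x < place k a b y
place-mono k a {b} a+k≤b {x} {y} x<y with x <? k | y <? k
... | yes _   | yes _   = +-monoʳ-< a x<y
... | yes x<k | no _    = <-≤-trans (+-monoʳ-< a x<k) (≤-trans a+k≤b (m≤m+n b (y ∸ k)))
... | no x≮k  | yes y<k = ⊥-elim (x≮k (<-trans x<y y<k))
... | no x≮k  | no _    = +-monoʳ-< b (∸-monoˡ-< x<y (≮⇒≥ x≮k))

Image-Join : ∀ k a b l → Image (place k a b) (Join 0 k k l) ≐ Join a k b l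
Image-Join k a b l = to , from
  where
  to : Image (place k a b) (Join 0 k k l) ⊆ Join a k b l
  to ((x , y) , ((_ , x<k) , (k≤y , y<k+l)) , refl)
    rewrite place-< {k} {a} {b} x<k with y′ , refl ← m≤n⇒∃[o]m+o≡n k≤y rewrite place-+ k {a} {b} y′ =
    (m≤m+n a x , +-monoʳ-< a x<k) , (m≤m+n b y′ , +-monoʳ-< b (+-cancelˡ-< k y′ l y<k+l))

  from : Join a k b l ⊆ Image (place k a b) (Join 0 k k l)
  from ((a≤u , u<a+k) , (b≤v , v<b+l))
    with x , refl ← m≤n⇒∃[o]m+o≡n a≤u | y , refl ← m≤n⇒∃[o]m+o≡n b≤v =
    (x , k + y) ,
    ((z≤n , x<k) , (m≤m+n k y , +-monoʳ-< k (+-cancelˡ-< b y l v<b+l))) ,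
    cong₂ _,_ (sym (place-< x<k)) (sym (place-+ k y))
    where
    x<k : x < k
    x<k = +-cancelˡ-< a x k u<a+k

placeJoin : ∀ {k a b l ℓ} → a + k ≤ b → Decomposition (Join 0 k k l) ℓ → Decomposition (Join a k b l) ℓ
placeJoin {k} {a} {b} {l} a+k≤b D = resp-≐ (Image-Join k a b l) (relabel (place-mono k a a+k≤b) D)

Join-splitˡ : ∀ a k k′ b l → Join a k b l ∪ Join (a + k) k′ b l ≐ Join a (k + k′) b l
Join-splitˡ a k k′ b l = to , from
  where
  to : Join a k b l ∪ Join (a + k) k′ b l ⊆ Join a (k + k′) b l
  to (inj₁ ((p , q) , r)) = (p , <-≤-trans q (+-monoʳ-≤ a (m≤m+n k k′))) , r
  to (inj₂ ((p , q) , r)) = (≤-trans (m≤m+n a k) p , <-≤-trans q (≤-reflexive (+-assoc a k k′))) , r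

  from : Join a (k + k′) b l ⊆ Join a k b l ∪ Join (a + k) k′ b l
  from {x , _} ((p , q) , r) with x <? a + k
  ... | yes x<a+k = inj₁ ((p , x<a+k) , r)
  ... | no  x≮a+k = inj₂ ((≮⇒≥ x≮a+k , <-≤-trans q (≤-reflexive (sym (+-assoc a k k′)))) , r)

Join-splitʳ : ∀ a k b l l′ → Join a k b l ∪ Join a k (b + l) l′ ≐ Join a k b (l + l′)
Join-splitʳ a k b l l′ = to , from
  where
  to : Join a k b l ∪ Join a k (b + l) l′ ⊆ Join a k b (l + l′)
  to (inj₁ (r , (p , q))) = r , (p , <-≤-trans q (+-monoʳ-≤ b (m≤m+n l l′)))
  to (inj₂ (r , (p , q))) = r , (≤-trans (m≤m+n b l) p , <-≤-trans q (≤-reflexive (+-assoc b l l′)))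

  from : Join a k b (l + l′) ⊆ Join a k b l ∪ Join a k (b + l) l′
  from {_ , y} (r , (p , q)) with y <? b + l
  ... | yes y<b+l = inj₁ (r , (p , y<b+l))
  ... | no  y≮b+l = inj₂ (r , (≮⇒≥ y≮b+l , <-≤-trans q (≤-reflexive (sym (+-assoc b l l′)))))

-- Four vertices of the even side are split off at a time, so an even size of at least 4 ends at
-- `K₄,₄` or at `K₆,₄`.
joinStrip : ∀ p {a b} → a + (4 + p * 2) ≤ b → Decomposition (Join a (4 + p * 2) b 4) 0
joinStrip zero          h = placeJoin h decomposition₄₄
joinStrip (suc zero)    h = placeJoin h decomposition₆₄
joinStrip (suc (suc p)) {a} {b} h = resp-≐ (Join-splitˡ a 4 (4 + p * 2) b 4)
  (union (λ ((_ , u) , _) ((v , _) , _) → <⇒≱ u v)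
    (joinStrip zero (≤-trans (+-monoʳ-≤ a (m≤m+n 4 (4 + p * 2))) h))
    (joinStrip p (≤-trans (≤-reflexive (+-assoc a 4 (4 + p * 2))) h)))

joinDecomposition : ∀ t p {a b} → a + (4 + p * 2) ≤ b → Decomposition (Join a (4 + p * 2) b (t * 4)) 0
joinDecomposition zero    p {b = b} _ =
  empty λ (_ , (u , v)) → <⇒≱ v (≤-trans (≤-reflexive (+-identityʳ b)) u)
joinDecomposition (suc t) p {a} {b} h = resp-≐ (Join-splitʳ a (4 + p * 2) b 4 (t * 4))
  (union (λ (_ , (_ , u)) (_ , (v , _)) → <⇒≱ u v)
    (joinStrip p h)
    (joinDecomposition t p (≤-trans h (m≤m+n b 4))))

-- What a complete graph on `r` shared and `s` new vertices adds to the old graph. For `r ≤ 1` this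
-- is all of its edges, since the shared vertices span none.
Outer : (r m s : ℕ) → Pred Pair 0ℓ
Outer r m s (x , y) = x < y × (m ≤ y × y < m + s) × (x < r ⊎ m ≤ x)

Image-K : ∀ {r} m s → r ≤ 1 → r ≤ m → Image (place r 0 m) (K (r + s)) ≐ Outer r m s
Image-K {r} m s r≤1 r≤m = to , from
  where
  to : Image (place r 0 m) (K (r + s)) ⊆ Outer r m s
  to ((x , y) , (x<y , y<r+s) , refl)
    -- The larger end of an edge is at least 1, hence not shared because `r ≤ 1`.
    with y′ , refl ← m≤n⇒∃[o]m+o≡n (≤-trans r≤1 (≤-trans (s≤s z≤n) x<y)) =
    place-mono r 0 r≤m x<y ,
    subst (λ v → m ≤ v × v < m + s) (sym (place-+ r y′))
      (m≤m+n m y′ , +-monoʳ-< m (+-cancelˡ-< r y′ s y<r+s)) ,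
    below (x <? r)
    where
    below : Dec (x < r) → place r 0 m x < r ⊎ m ≤ place r 0 m x
    below (yes x<r) = inj₁ (subst (_< r) (sym (place-< x<r)) x<r)
    below (no x≮r)  = inj₂ (subst (m ≤_) (sym (place-≥ (≮⇒≥ x≮r))) (m≤m+n m (x ∸ r)))

  from : Outer r m s ⊆ Image (place r 0 m) (K (r + s))
  from {u , v} (u<v , (m≤v , v<m+s) , c) with y , refl ← m≤n⇒∃[o]m+o≡n m≤v = go c
    where
    y<s = +-cancelˡ-< m y s v<m+s
    go : u < r ⊎ m ≤ u → Image (place r 0 m) (K (r + s)) (u , m + y)
    go (inj₁ u<r) = (u , r + y) , (<-≤-trans u<r (m≤m+n r y) , +-monoʳ-< r y<s) ,
      cong₂ _,_ (sym (place-< u<r)) (sym (place-+ r y))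
    go (inj₂ m≤u) with x , refl ← m≤n⇒∃[o]m+o≡n m≤u =
      (r + x , r + y) , (+-monoʳ-< r (+-cancelˡ-< m x y u<v) , +-monoʳ-< r y<s) ,
      cong₂ _,_ (sym (place-+ r x)) (sym (place-+ r y))

-- If the larger end is new, the smaller one is shared, new, or old and unshared; only the last case
-- belongs to the bipartite graph.
K-glue : ∀ r q s → (K (r + q) ∪ Outer r (r + q) s) ∪ Join r q (r + q) s ≐ K (s + (r + q))
K-glue r q s = to , from
  where
  m = r + q
  to : (K m ∪ Outer r m s) ∪ Join r q m s ⊆ K (s + m)
  to (inj₁ (inj₁ (x<y , y<m)))             = x<y , <-≤-trans y<m (m≤n+m m s)
  to (inj₁ (inj₂ (x<y , (_ , y<m+s) , _))) = x<y , <-≤-trans y<m+s (≤-reflexive (+-comm m s))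
  to (inj₂ ((_ , x<m) , (m≤y , y<m+s)))    =
    <-≤-trans x<m m≤y , <-≤-trans y<m+s (≤-reflexive (+-comm m s))

  new : ∀ {y} → y < s + m → ¬ (y < m) → m ≤ y × y < m + s
  new y<s+m y≮m = ≮⇒≥ y≮m , <-≤-trans y<s+m (≤-reflexive (+-comm s m))

  from : K (s + m) ⊆ (K m ∪ Outer r m s) ∪ Join r q m s
  from {x , y} (x<y , y<s+m) with y <? m | x <? r | x <? m
  ... | yes y<m | _       | _       = inj₁ (inj₁ (x<y , y<m))
  ... | no y≮m  | yes x<r | _       = inj₁ (inj₂ (x<y , new y<s+m y≮m , inj₁ x<r))
  ... | no y≮m  | no _    | no x≮m  = inj₁ (inj₂ (x<y , new y<s+m y≮m , inj₂ (≮⇒≥ x≮m)))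
  ... | no y≮m  | no x≮r  | yes x<m = inj₂ ((≮⇒≥ x≮r , x<m) , new y<s+m y≮m)

-- The bipartite part has an empty leave, so only the two complete graphs contribute. With the order
-- written as `t * 4 + m`, gluing sixteen new points to `q * 16 + b` computes to `suc q * 16 + b`.
glue : ∀ {r m ℓ ℓ′} p t → r ≤ 1 → m ≡ r + (4 + p * 2) →
       Decomposition (K m) ℓ → Decomposition (K (r + t * 4)) ℓ′ → Decomposition (K (t * 4 + m)) (ℓ + ℓ′)
glue {r} {_} {ℓ} {ℓ′} p t r≤1 refl D D′ = subst (Decomposition _) (+-identityʳ (ℓ + ℓ′))
  (resp-≐ (K-glue r (4 + p * 2) (t * 4))
    (union (λ { (inj₁ (_ , y<m)) (_ , (m≤y , _))          → <⇒≱ y<m m≤y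
              ; (inj₂ (_ , _ , inj₁ x<r)) ((r≤x , _) , _) → <⇒≱ x<r r≤x
              ; (inj₂ (_ , _ , inj₂ m≤x)) ((_ , x<m) , _) → <⇒≱ x<m m≤x })
      (union (λ (_ , y<m) (_ , (m≤y , _) , _) → <⇒≱ y<m m≤y)
        D
        (resp-≐ (Image-K m (t * 4) r≤1 r≤m) (relabel (place-mono r 0 r≤m) D′)))
      (joinDecomposition t p ≤-refl)))
  where
  m = r + (4 + p * 2)
  r≤m : r ≤ m
  r≤m = m≤m+n r (4 + p * 2)

-- Remaining small orders and extension by sixteen points

decomposition₁₂ : Decomposition (K 12) 10
decomposition₁₂ = glue 2 1 z≤n refl decomposition₈ decomposition₄

decomposition₁₄ : Decomposition (K 14) 11
decomposition₁₄ = glue 3 1 z≤n refl decomposition₁₀ decomposition₄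

decomposition₁₆ : Decomposition (K 16) 8
decomposition₁₆ = glue 2 2 z≤n refl decomposition₈ decomposition₈

decomposition₁₈ : Decomposition (K 18) 9
decomposition₁₈ = glue 3 2 z≤n refl decomposition₁₀ decomposition₈

decomposition₂₀ : Decomposition (K 20) 14
decomposition₂₀ = glue 6 1 z≤n refl decomposition₁₆ decomposition₄

decomposition₂₁ : Decomposition (K 21) 10
decomposition₂₁ = glue 6 1 (s≤s z≤n) refl decomposition₁₇ decomposition₅

decomposition₂₂ : Decomposition (K 22) 15
decomposition₂₂ = glue 7 1 z≤n refl decomposition₁₈ decomposition₄

-- Each copy of `decomposition₁₆` adds 8 edges to the leave, exactly the growth of the lower bound
-- n/2.
extendEven : ∀ p {ℓ} → Decomposition (K (4 + p * 2)) ℓ →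
             ∀ q → Decomposition (K (q * 16 + (4 + p * 2))) (q * 8 + ℓ)
extendEven p D zero    = D
extendEven p {ℓ} D (suc q) = subst (Decomposition _) (shift q ℓ)
  (glue (q * 8 + p) 4 z≤n (eq q p) (extendEven p D q) decomposition₁₆)
  where
  shift : ∀ q ℓ → q * 8 + ℓ + 8 ≡ 8 + q * 8 + ℓ
  shift = solve-∀
  eq : ∀ q p → q * 16 + (4 + p * 2) ≡ 4 + (q * 8 + p) * 2
  eq = solve-∀

-- Each copy of `decomposition₁₇` shares one point with the old part and adds nothing to the leave.
extendOdd : ∀ p {ℓ} → Decomposition (K (5 + p * 2)) ℓ →
            ∀ q → Decomposition (K (q * 16 + (5 + p * 2))) ℓ
extendOdd p D zero    = D
extendOdd p {ℓ} D (suc q) = subst (Decomposition _) (+-identityʳ ℓ)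
  (glue (q * 8 + p) 4 (s≤s z≤n) (eq q p) (extendOdd p D q) decomposition₁₇)
  where
  eq : ∀ q p → q * 16 + (5 + p * 2) ≡ 5 + (q * 8 + p) * 2
  eq = solve-∀

-- Packings as decompositions of complete graphs

unordered-< : ∀ {x y} → x < y → unordered x y ≡ (x , y)
unordered-< x<y = cong₂ _,_ (m≤n⇒m⊓n≡m (<⇒≤ x<y)) (m≤n⇒m⊔n≡n (<⇒≤ x<y))

unordered-comm : ∀ x y → unordered x y ≡ unordered y x
unordered-comm x y = cong₂ _,_ (⊓-comm x y) (⊔-comm x y)

unordered-cases : ∀ x y → unordered x y ≡ (x , y) ⊎ unordered x y ≡ (y , x)
unordered-cases x y with ≤-total x y
... | inj₁ x≤y = inj₁ (cong₂ _,_ (m≤n⇒m⊓n≡m x≤y) (m≤n⇒m⊔n≡n x≤y))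
... | inj₂ y≤x = inj₂ (cong₂ _,_ (m≥n⇒m⊓n≡n y≤x) (m≥n⇒m⊔n≡m y≤x))

unordered-≡ : ∀ {x y u v} → unordered x y ≡ unordered u v → (x ≡ u × y ≡ v) ⊎ (x ≡ v × y ≡ u)
unordered-≡ {x} {y} {u} {v} eq with unordered-cases x y | unordered-cases u v
... | inj₁ p | inj₁ q = inj₁ (,-injective (trans (sym p) (trans eq q)))
... | inj₁ p | inj₂ q = inj₂ (,-injective (trans (sym p) (trans eq q)))
... | inj₂ p | inj₁ q with r , s ← ,-injective (trans (sym p) (trans eq q)) = inj₂ (s , r)
... | inj₂ p | inj₂ q with r , s ← ,-injective (trans (sym p) (trans eq q)) = inj₁ (s , r)

next-≢ : ∀ i → next i ≢ i
next-≢ = toWitness {a? = all? λ i → ¬? (next i ≟ᶠ i)} _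

next²-≢ : ∀ i → next (next i) ≢ i
next²-≢ = toWitness {a? = all? λ i → ¬? (next (next i) ≟ᶠ i)} _

∈-circuitEdges⁺ : ∀ c i → edgeAt c i ∈ circuitEdges c
∈-circuitEdges⁺ c = ∈-tabulate⁺ {f = edgeAt c}

∈-circuitEdges⁻ : ∀ c {e} → e ∈ circuitEdges c → ∃ λ i → e ≡ edgeAt c i
∈-circuitEdges⁻ c = ∈-tabulate⁻ {f = edgeAt c}

-- If the edges at `i` and `j` agreed with opposite orientations, then two steps from `j` would lead
-- back to `j`, impossible in a cycle of length 8.
circuitEdges-unique : ∀ {c} → Injective _≡_ _≡_ c → Unique (circuitEdges c)
circuitEdges-unique {c} inj = Unique.tabulate⁺ {f = edgeAt c} distinct
  where
  distinct : ∀ {i j} → edgeAt c i ≡ edgeAt c j → i ≡ j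
  distinct {i} {j} eq with unordered-≡ eq
  ... | inj₁ (p , _) = inj p
  ... | inj₂ (p , q) = ⊥-elim (next²-≢ j (trans (sym (cong next (inj p))) (inj q)))

circuitEdges-bound : ∀ {n c} → (∀ {e} → e ∈ circuitEdges c → K n e) → ∀ i → c i < n
circuitEdges-bound {c = c} h i =
  ≤-<-trans (m≤m⊔n (c i) (c (next i))) (proj₂ (h (∈-circuitEdges⁺ c i)))

++-disjoint : ∀ {xs ys : List Pair} → Unique (xs ++ ys) → Disjoint xs ys
++-disjoint {x ∷ xs} (x∉ ∷ u) (Any.here refl , q) = All.lookup x∉ (∈-++⁺ʳ xs q) refl
++-disjoint {x ∷ xs} (x∉ ∷ u) (Any.there p , q)   = ++-disjoint u (p , q)

++-uniqueʳ : ∀ (xs : List Pair) {ys} → Unique (xs ++ ys) → Unique ys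
++-uniqueʳ []       u       = u
++-uniqueʳ (_ ∷ xs) (_ ∷ u) = ++-uniqueʳ xs u

module _ {n : ℕ} where

  open Edge
  open Cycle₈
  open IsPacking

  pair : Edge n → Pair
  pair e = toℕ (lo e) , toℕ (hi e)

  pair-injective : ∀ {e f} → pair e ≡ pair f → e ≡ f
  pair-injective {edge _ _ _} {edge _ _ _} eq with p , q ← ,-injective eq
    with refl ← toℕ-injective p | refl ← toℕ-injective q = refl

  pair-K : ∀ e → K n (pair e)
  -- The order proof is irrelevant, so it is recovered from decidability.
  pair-K (edge x y x<y) = recompute (toℕ x <? toℕ y) x<y , toℕ<n y

  K⇒pair : ∀ {p} → K n p → ∃[ e ] pair e ≡ p
  K⇒pair {x , y} (x<y , y<n) = edge (fromℕ< x<n) (fromℕ< y<n)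
    (subst₂ _<_ (sym (toℕ-fromℕ< x<n)) (sym (toℕ-fromℕ< y<n)) x<y) ,
    cong₂ _,_ (toℕ-fromℕ< x<n) (toℕ-fromℕ< y<n)
    where
    x<n : x < n
    x<n = <-trans x<y y<n

  circuit : Cycle₈ n → Circuit
  circuit C i = toℕ (vertex C i)

  cycleEdges : Cycle₈ n → List Pair
  cycleEdges C = circuitEdges (circuit C)

  ∈E⇒∈ : ∀ {e C} → e ∈E C → pair e ∈ cycleEdges C
  ∈E⇒∈ {e} {C} (i , inj₁ (p , q)) = subst (_∈ cycleEdges C)
    (trans (cong₂ unordered (cong toℕ (sym p)) (cong toℕ (sym q))) (unordered-< (proj₁ (pair-K e))))
    (∈-circuitEdges⁺ (circuit C) i)
  ∈E⇒∈ {e} {C} (i , inj₂ (p , q)) = subst (_∈ cycleEdges C)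
    (trans (trans (unordered-comm (circuit C i) _) (cong₂ unordered (cong toℕ (sym p)) (cong toℕ (sym q))))
      (unordered-< (proj₁ (pair-K e))))
    (∈-circuitEdges⁺ (circuit C) i)

  ∈⇒∈E : ∀ {e C} → pair e ∈ cycleEdges C → e ∈E C
  ∈⇒∈E {e} {C} h with i , eq ← ∈-circuitEdges⁻ (circuit C) h
    with unordered-≡ (trans (unordered-< (proj₁ (pair-K e))) eq)
  ... | inj₁ (p , q) = i , inj₁ (toℕ-injective p , toℕ-injective q)
  ... | inj₂ (p , q) = i , inj₂ (toℕ-injective p , toℕ-injective q)

  cycleEdges-K : ∀ {p} C → p ∈ cycleEdges C → K n p
  cycleEdges-K C h with i , refl ← ∈-circuitEdges⁻ (circuit C) h =
    ⊓<⊔ (λ eq → next-≢ i (sym (injective C (toℕ-injective eq)))) ,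
    ⊔-pres-<m (toℕ<n (vertex C i)) (toℕ<n (vertex C (next i)))
    where
    ⊓<⊔ : ∀ {x y} → x ≢ y → x ⊓ y < x ⊔ y
    ⊓<⊔ {x} {y} x≢y = ≤∧≢⇒< (≤-trans (m⊓n≤m x y) (m≤m⊔n x y)) λ eq → x≢y (≤-antisym
      (≤-trans (m≤m⊔n x y) (≤-trans (≤-reflexive (sym eq)) (m⊓n≤n x y)))
      (≤-trans (m≤n⊔m x y) (≤-trans (≤-reflexive (sym eq)) (m⊓n≤m x y))))

  edgeDisjoint⇒disjoint : ∀ {C D} → EdgeDisjoint C D → Disjoint (cycleEdges C) (cycleEdges D)
  edgeDisjoint⇒disjoint {C} {D} h (p , q) with e , refl ← K⇒pair (cycleEdges-K C p) =
    h e (∈⇒∈E {e} {C} p , ∈⇒∈E {e} {D} q)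

  disjoint⇒edgeDisjoint : ∀ {C D} → Disjoint (cycleEdges C) (cycleEdges D) → EdgeDisjoint C D
  disjoint⇒edgeDisjoint {C} {D} h e (p , q) = h (∈E⇒∈ {e} {C} p , ∈E⇒∈ {e} {D} q)

  ∈E-any⇒∈ : ∀ {e 𝒞} → Any (e ∈E_) 𝒞 → pair e ∈ concatMap cycleEdges 𝒞
  ∈E-any⇒∈ {e} = ∈-concatMap⁺ cycleEdges ∘ Any.map (λ {C} → ∈E⇒∈ {e} {C})

  ∈⇒∈E-any : ∀ {e 𝒞} → pair e ∈ concatMap cycleEdges 𝒞 → Any (e ∈E_) 𝒞
  ∈⇒∈E-any {e} {𝒞} = Any.map (λ {C} → ∈⇒∈E {e} {C}) ∘ ∈-concatMap⁻ cycleEdges {xs = 𝒞}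

  -- Brings an arbitrary competing packing into the form to which the lower bounds apply.
  packing⇒splits : ∀ {𝒞 ℒ} → IsPacking 𝒞 ℒ → Splits (K n) (map pair ℒ) (concatMap cycleEdges 𝒞)
  packing⇒splits {𝒞} {ℒ} P = record
    { ls-unique = Unique.map⁺ pair-injective (leave-unique P)
    ; es-unique = Unique.concat⁺
        (All.map⁺ (All.universal (λ C → circuitEdges-unique (injective C ∘ toℕ-injective)) 𝒞))
        (AllPairs.map⁺ (AllPairs.map (λ {C} {D} → edgeDisjoint⇒disjoint {C} {D}) (edge-disjoint P)))
    ; separate  = sep
    ; ls-sound  = λ h → let e , _ , eq = ∈-map⁻ pair h in subst (K n) (sym eq) (pair-K e)
    ; es-sound  = λ h → let C , _ , p∈C = find (∈-concatMap⁻ cycleEdges {xs = 𝒞} h) in cycleEdges-K C p∈C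
    ; complete  = compl
    }
    where
    sep : Disjoint (map pair ℒ) (concatMap cycleEdges 𝒞)
    sep (p , q) with e , e∈ℒ , refl ← ∈-map⁻ pair p =
      Equivalence.to (leave-edges P e) e∈ℒ (∈⇒∈E-any {e} q)

    compl : ∀ {p} → K n p → p ∈ map pair ℒ ⊎ p ∈ concatMap cycleEdges 𝒞
    compl {p} Kp with p ∈? concatMap cycleEdges 𝒞 | K⇒pair Kp
    ... | yes p∈ | _        = inj₂ p∈
    ... | no  p∉ | e , refl =
      inj₁ (∈-map⁺ pair (Equivalence.from (leave-edges P e) (p∉ ∘ ∈E-any⇒∈ {e})))

  splits⇒packing : ∀ {𝒞 ℒ} → Splits (K n) (map pair ℒ) (concatMap cycleEdges 𝒞) → IsPacking 𝒞 ℒ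
  splits⇒packing {𝒞} {ℒ} s = record
    { edge-disjoint = disj 𝒞 (es-unique s)
    ; leave-unique  = Unique.map⁻ (ls-unique s)
    ; leave-edges   = λ e → mk⇔
        (λ e∈ℒ any → separate s (∈-map⁺ pair e∈ℒ , ∈E-any⇒∈ {e} any))
        (λ ¬any → [ in-leave e , ⊥-elim ∘ ¬any ∘ ∈⇒∈E-any {e} ]′ (complete s (pair-K e)))
    }
    where
    disj : ∀ 𝒞 → Unique (concatMap cycleEdges 𝒞) → AllPairs EdgeDisjoint 𝒞
    disj []      _ = []
    disj (C ∷ 𝒞) u =
      All.tabulate (λ {D} D∈𝒞 → disjoint⇒edgeDisjoint {C} {D} λ (p , q) →
        ++-disjoint u (p , ∈-concatMap⁺ cycleEdges (lose D∈𝒞 q))) ∷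
      disj 𝒞 (++-uniqueʳ (cycleEdges C) u)

    in-leave : ∀ e → pair e ∈ map pair ℒ → e ∈ ℒ
    in-leave e h with f , f∈ℒ , eq ← ∈-map⁻ pair h with refl ← pair-injective {e} {f} eq = f∈ℒ

  realiseCycle : ∀ {c} → Injective _≡_ _≡_ c → (∀ i → c i < n) → ∃[ C ] (∀ i → circuit C i ≡ c i)
  realiseCycle {c} inj bound = record
    { vertex    = λ i → fromℕ< (bound i)
    ; injective = λ {i} {j} eq → inj (begin
        c i                    ≡⟨ toℕ-fromℕ< (bound i) ⟨
        toℕ (fromℕ< (bound i)) ≡⟨ cong toℕ eq ⟩
        toℕ (fromℕ< (bound j)) ≡⟨ toℕ-fromℕ< (bound j) ⟩
        c j                    ∎)
    } , λ i → toℕ-fromℕ< (bound i)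
    where open ≡-Reasoning

  cycleEdges-circuit : ∀ {C c} → (∀ i → circuit C i ≡ c i) → cycleEdges C ≡ circuitEdges c
  cycleEdges-circuit eq = tabulate-cong λ i → cong₂ unordered (eq i) (eq (next i))

  inside-circuit : ∀ {C D c d} → (∀ i → circuit C i ≡ c i) → (∀ i → circuit D i ≡ d i) →
                   IsInside d c → D Inside C
  inside-circuit {C} {D} {c} {d} eqC eqD v =
    (λ u → mk⇔
      (λ (i , eq) → let j , eq′ = d⊆c i in
        j , trans eq (toℕ-injective (trans (eqD i) (trans eq′ (sym (eqC j))))))
      (λ (i , eq) → let j , eq′ = c⊆d i in
        j , trans eq (toℕ-injective (trans (eqC i) (trans eq′ (sym (eqD j))))))) ,
    disjoint⇒edgeDisjoint {D} {C} (subst₂ Disjoint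
      (sym (cycleEdges-circuit {D} eqD)) (sym (cycleEdges-circuit {C} eqC)) disjoint)
    where open IsInside v

  realiseBlocks : ∀ bs → All Valid bs →
    (∀ {e} → e ∈ outerEdges bs → K n e) → (∀ {e} → e ∈ innerEdges bs → K n e) →
    ∃[ 𝒞 ] ∃[ 𝒞′ ] Pointwise _Inside_ 𝒞′ 𝒞
      × concatMap cycleEdges 𝒞 ≡ outerEdges bs × concatMap cycleEdges 𝒞′ ≡ innerEdges bs
  realiseBlocks []       []       _ _ = [] , [] , [] , refl , refl
  realiseBlocks (b ∷ bs) (v ∷ vs) h k
    with C , eqC ← realiseCycle (IsInside.c-injective v) (circuitEdges-bound (h ∘ ∈-++⁺ˡ))
       | D , eqD ← realiseCycle (IsInside.d-injective v) (circuitEdges-bound (k ∘ ∈-++⁺ˡ))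
       | 𝒞 , 𝒞′ , ins , eq , eq′ ← realiseBlocks bs vs
           (h ∘ ∈-++⁺ʳ (circuitEdges (outer b))) (k ∘ ∈-++⁺ʳ (circuitEdges (inner b))) =
    C ∷ 𝒞 , D ∷ 𝒞′ , inside-circuit {C} {D} eqC eqD v ∷ ins ,
    cong₂ _++_ (cycleEdges-circuit {C} eqC) eq , cong₂ _++_ (cycleEdges-circuit {D} eqD) eq′

  realiseLeave : ∀ ls → (∀ {e} → e ∈ ls → K n e) → ∃[ ℒ ] map pair ℒ ≡ ls
  realiseLeave []       _ = [] , refl
  realiseLeave (l ∷ ls) h with e , eq ← K⇒pair (h (Any.here refl)) | ℒ , eqs ← realiseLeave ls (h ∘ Any.there) =
    e ∷ ℒ , cong₂ _∷_ eq eqs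

  -- The leave is realised once and used for both packings, as almost 2-perfection demands.
  realise : ∀ {ℓ} → Decomposition (K n) ℓ →
            Σ[ P ∈ Packing n ] AlmostTwoPerfect P × length (Packing.leave P) ≡ ℓ
  realise D
    with 𝒞 , 𝒞′ , ins , eq , eq′ ← realiseBlocks (blocks D) (valid D)
           (es-sound (outer-splits D)) (es-sound (inner-splits D))
       | ℒ , eqℒ ← realiseLeave (leave D) (ls-sound (outer-splits D)) =
    record { cycles = 𝒞 ; leave = ℒ
           ; isPacking = splits⇒packing (subst₂ (Splits (K n)) (sym eqℒ) (sym eq) (outer-splits D)) } ,
    (𝒞′ , ins , splits⇒packing (subst₂ (Splits (K n)) (sym eqℒ) (sym eq′) (inner-splits D))) ,
    trans (sym (length-map pair ℒ)) (trans (cong length eqℒ) (leave-size D))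

-- Lower bounds for the leave

∈-pairs⁻ : ∀ {n e} → e ∈ pairs n → K n e
∈-pairs⁻ {suc n} h with ∈-++⁻ (map (_, n) (downFrom n)) h
... | inj₁ p with x , x∈ , refl ← ∈-map⁻ (_, n) p = ∈-downFrom⁻ x∈ , ≤-refl
... | inj₂ p with x<y , y<n ← ∈-pairs⁻ {n} p = x<y , m≤n⇒m≤1+n y<n

pairs-unique : ∀ n → Unique (pairs n)
pairs-unique zero    = []
pairs-unique (suc n) = Unique.++⁺ (Unique.map⁺ (cong proj₁) (Unique.downFrom⁺ n)) (pairs-unique n) disj
  where
  disj : ∀ {e} → ¬ (e ∈ map (_, n) (downFrom n) × e ∈ pairs n)
  disj (p , q) with x , _ , refl ← ∈-map⁻ (_, n) p = <-irrefl refl (proj₂ (∈-pairs⁻ {n} q))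

-- Two duplicate-free lists with the same members are permutations of each other; lengths and
-- degrees can therefore be compared with those of the complete graph.
splits⇒↭ : ∀ {n ls es} → Splits (K n) ls es → ls ++ es ↭ pairs n
splits⇒↭ {n} {ls} {es} s = ∼bag⇒↭ (unique∧set⇒bag
  (Unique.++⁺ (ls-unique s) (es-unique s) (separate s)) (pairs-unique n)
  (mk⇔ (∈-pairs⁺ ∘ [ ls-sound s , es-sound s ]′ ∘ ∈-++⁻ ls)
       ([ ∈-++⁺ˡ , ∈-++⁺ʳ ls ]′ ∘ complete s ∘ ∈-pairs⁻ {n})))

-- The number n(n - 1)/2, without division.
triangle : ℕ → ℕ
triangle zero    = 0
triangle (suc n) = n + triangle n

length-pairs : ∀ n → length (pairs n) ≡ triangle n
length-pairs zero    = refl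
length-pairs (suc n) = trans (length-++ (map (_, n) (downFrom n)))
  (cong₂ _+_ (trans (length-map (_, n) (downFrom n)) (length-downFrom n)) (length-pairs n))

-- Sixteen vertices added to `m` bring 16m + 120 = 8(2m + 15) further edges, so the residue has
-- period 16.
triangle-mod-8 : ∀ q b → ∃[ w ] triangle (q * 16 + b) ≡ triangle b + 8 * w
triangle-mod-8 zero    b = 0 , sym (+-identityʳ (triangle b))
triangle-mod-8 (suc q) b with w , eq ← triangle-mod-8 q b =
  w + (2 * (q * 16 + b) + 15) , trans (period (q * 16 + b) (triangle (q * 16 + b)))
    (trans (cong (_+ 8 * (2 * (q * 16 + b) + 15)) eq) (regroup (triangle b) w (2 * (q * 16 + b) + 15)))
  where
  period : ∀ m t → 15 + m + (14 + m + (13 + m + (12 + m + (11 + m + (10 + m + (9 + m + (8 + m +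
    (7 + m + (6 + m + (5 + m + (4 + m + (3 + m + (2 + m + (1 + m + (m + t))))))))))))))) ≡ t + 8 * (2 * m + 15)
  period = solve-∀
  regroup : ∀ t w v → t + 8 * w + 8 * v ≡ t + 8 * (w + v)
  regroup = solve-∀

-- Degrees and the handshake inequality

indicator : ℕ → ℕ → ℕ
indicator v x = if does (v ≟ x) then 1 else 0

indicator-≡ : ∀ v → indicator v v ≡ 1
indicator-≡ v = cong (if_then 1 else 0) (dec-true (v ≟ v) refl)

indicator-≢ : ∀ {v x} → v ≢ x → indicator v x ≡ 0
indicator-≢ {v} {x} v≢x = cong (if_then 1 else 0) (dec-false (v ≟ x) v≢x)

ends : ℕ → Pair → ℕ
ends v (x , y) = indicator v x + indicator v y

degree : ℕ → List Pair → ℕ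
degree v es = sum (map (ends v) es)

degree-++ : ∀ v es fs → degree v (es ++ fs) ≡ degree v es + degree v fs
degree-++ v es fs = trans (cong sum (map-++ (ends v) es fs)) (sum-++ (map (ends v) es) (map (ends v) fs))

ends-unordered : ∀ v x y → ends v (unordered x y) ≡ indicator v x + indicator v y
ends-unordered v x y with unordered-cases x y
... | inj₁ eq = cong (ends v) eq
... | inj₂ eq = trans (cong (ends v) eq) (+-comm (indicator v y) (indicator v x))

-- Every position of the circuit is an end of two consecutive edges, so its indicator is counted
-- twice.
degree-circuit : ∀ v c → ∃[ k ] degree v (circuitEdges c) ≡ 2 * k
degree-circuit v c = sum (tabulate f) , (begin
  sum (map (ends v) (tabulate (edgeAt c)))   ≡⟨ cong sum (map-tabulate (edgeAt c) (ends v)) ⟩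
  sum (tabulate (ends v ∘ edgeAt c))         ≡⟨ cong sum (tabulate-cong λ i → ends-unordered v (c i) (c (next i))) ⟩
  sum (tabulate (λ i → f i + f (next i)))    ≡⟨ double (f 0F) (f 1F) (f 2F) (f 3F) (f 4F) (f 5F) (f 6F) (f 7F) ⟩
  2 * sum (tabulate f)                       ∎)
  where
  open ≡-Reasoning
  f : Fin 8 → ℕ
  f i = indicator v (c i)
  double : ∀ a b c d e f g h →
    a + b + (b + c + (c + d + (d + e + (e + f + (f + g + (g + h + (h + a + 0)))))))
      ≡ 2 * (a + (b + (c + (d + (e + (f + (g + (h + 0))))))))
  double = solve-∀

degree-circuits : ∀ v cs → ∃[ k ] degree v (concatMap circuitEdges cs) ≡ 2 * k
degree-circuits v []       = 0 , refl
degree-circuits v (c ∷ cs) with k , eq ← degree-circuit v c | k′ , eq′ ← degree-circuits v cs =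
  k + k′ , trans (degree-++ v (circuitEdges c) (concatMap circuitEdges cs))
    (trans (cong₂ _+_ eq eq′) (sym (*-distribˡ-+ 2 k k′)))

length-circuits : ∀ cs → length (concatMap circuitEdges cs) ≡ 8 * length cs
length-circuits []       = refl
length-circuits (c ∷ cs) = trans (length-++ (circuitEdges c) {concatMap circuitEdges cs})
  (trans (cong (8 +_) (length-circuits cs)) (sym (*-suc 8 (length cs))))

Σ< : ℕ → (ℕ → ℕ) → ℕ
Σ< n f = sum (map f (downFrom n))

Σ<-indicator-≥ : ∀ {v} n → n ≤ v → Σ< n (indicator v) ≡ 0
Σ<-indicator-≥ zero    _   = refl
Σ<-indicator-≥ (suc n) n<v = cong₂ _+_ (indicator-≢ (>⇒≢ n<v)) (Σ<-indicator-≥ n (<⇒≤ n<v))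

Σ<-indicator-< : ∀ {v} n → v < n → Σ< n (indicator v) ≡ 1
Σ<-indicator-< {v} (suc n) (s≤s v≤n) with m≤n⇒m<n∨m≡n v≤n
... | inj₁ v<n  = cong₂ _+_ (indicator-≢ (<⇒≢ v<n)) (Σ<-indicator-< n v<n)
... | inj₂ refl = cong₂ _+_ (indicator-≡ v) (Σ<-indicator-≥ n ≤-refl)

degree-star : ∀ v n xs → degree v (map (_, n) xs) ≡ sum (map (indicator v) xs) + length xs * indicator v n
degree-star v n []       = refl
degree-star v n (x ∷ xs) = trans (cong (ends v (x , n) +_) (degree-star v n xs))
  (regroup (indicator v x) (indicator v n) (sum (map (indicator v) xs)) (length xs * indicator v n))
  where
  regroup : ∀ a b c d → a + b + (c + d) ≡ a + c + (b + d)
  regroup = solve-∀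

degree-pairs-suc : ∀ v n → degree v (pairs (suc n)) ≡ Σ< n (indicator v) + n * indicator v n + degree v (pairs n)
degree-pairs-suc v n = trans (degree-++ v (map (_, n) (downFrom n)) (pairs n))
  (cong (_+ degree v (pairs n)) (trans (degree-star v n (downFrom n))
    (cong (λ l → Σ< n (indicator v) + l * indicator v n) (length-downFrom n))))

degree-pairs-≥ : ∀ {v} n → n ≤ v → degree v (pairs n) ≡ 0
degree-pairs-≥ zero    _ = refl
degree-pairs-≥ {v} (suc n) n<v = trans (degree-pairs-suc v n)
  (cong₂ _+_ (cong₂ _+_ (Σ<-indicator-≥ n (<⇒≤ n<v)) (trans (cong (n *_) (indicator-≢ (>⇒≢ n<v))) (*-zeroʳ n)))
             (degree-pairs-≥ n (<⇒≤ n<v)))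

-- The successor avoids the truncated difference `n ∸ 1`.
degree-pairs-< : ∀ {v} n → v < n → suc (degree v (pairs n)) ≡ n
degree-pairs-< {v} (suc n) (s≤s v≤n) = trans (cong suc (degree-pairs-suc v n)) (go (m≤n⇒m<n∨m≡n v≤n))
  where
  go : v < n ⊎ v ≡ n → suc (Σ< n (indicator v) + n * indicator v n + degree v (pairs n)) ≡ suc n
  go (inj₁ v<n) rewrite Σ<-indicator-< n v<n | indicator-≢ (<⇒≢ v<n) | *-zeroʳ n =
    cong suc (degree-pairs-< n v<n)
  go (inj₂ refl) rewrite Σ<-indicator-≥ n v≤n | indicator-≡ n | degree-pairs-≥ n v≤n =
    cong suc (trans (+-identityʳ (n * 1)) (*-identityʳ n))

Σ<-+ : ∀ n f g → Σ< n (λ v → f v + g v) ≡ Σ< n f + Σ< n g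
Σ<-+ zero    f g = refl
Σ<-+ (suc n) f g = trans (cong (f n + g n +_) (Σ<-+ n f g)) (regroup (f n) (g n) (Σ< n f) (Σ< n g))
  where
  regroup : ∀ a b c d → a + b + (c + d) ≡ a + c + (b + d)
  regroup = solve-∀

Σ<-lower : ∀ n f → (∀ {v} → v < n → 1 ≤ f v) → n ≤ Σ< n f
Σ<-lower zero    f h = z≤n
Σ<-lower (suc n) f h = +-mono-≤ (h ≤-refl) (Σ<-lower n f (h ∘ m≤n⇒m≤1+n))

Σ<-indicator-flip : ∀ n x → Σ< n (λ v → indicator v x) ≤ 1
Σ<-indicator-flip n x = ≤-trans (≤-reflexive (cong sum (map-cong flip (downFrom n)))) (bound (x <? n))
  where
  flip : ∀ v → indicator v x ≡ indicator x v
  flip v = go (v ≟ x)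
    where
    go : Dec (v ≡ x) → indicator v x ≡ indicator x v
    go (yes refl) = refl
    go (no v≢x)   = trans (indicator-≢ v≢x) (sym (indicator-≢ (v≢x ∘ sym)))
  bound : Dec (x < n) → Σ< n (indicator x) ≤ 1
  bound (yes x<n) = ≤-reflexive (Σ<-indicator-< n x<n)
  bound (no x≮n)  = ≤-trans (≤-reflexive (Σ<-indicator-≥ n (≮⇒≥ x≮n))) z≤n

-- Only an inequality, because ends outside the first `n` vertices are not counted on the left.
handshake : ∀ n es → Σ< n (λ v → degree v es) ≤ 2 * length es
handshake n [] = ≤-reflexive (zeros n)
  where
  zeros : ∀ n → Σ< n (λ _ → 0) ≡ 0
  zeros zero    = refl
  zeros (suc n) = zeros n
handshake n ((x , y) ∷ es) = begin
  Σ< n (λ v → ends v (x , y) + degree v es)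
    ≡⟨ Σ<-+ n (λ v → ends v (x , y)) (λ v → degree v es) ⟩
  Σ< n (λ v → ends v (x , y)) + Σ< n (λ v → degree v es)
    ≡⟨ cong (_+ Σ< n (λ v → degree v es)) (Σ<-+ n (λ v → indicator v x) (λ v → indicator v y)) ⟩
  Σ< n (λ v → indicator v x) + Σ< n (λ v → indicator v y) + Σ< n (λ v → degree v es)
    ≤⟨ +-mono-≤ (+-mono-≤ (Σ<-indicator-flip n x) (Σ<-indicator-flip n y)) (handshake n es) ⟩
  2 + 2 * length es
    ≡⟨ *-suc 2 (length es) ⟨
  2 * suc (length es) ∎
  where open ≤-Reasoning

-- Residues modulo 8 and parity of degrees

-- Otherwise `a` would exceed `L` by a positive multiple of 8 that is smaller than 8. The congruence
-- has multiples of 8 on both sides, so no subtraction occurs.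
≤-from-≡-mod-8 : ∀ {L a} u w → L + 8 * u ≡ a + 8 * w → a < L + 8 → a ≤ L
≤-from-≡-mod-8 {L} {a} u w eq a<L+8 with a ≤? L
... | yes a≤L = a≤L
... | no  a≰L with d , refl ← m≤n⇒∃[o]m+o≡n (≰⇒> a≰L) =
  ⊥-elim (>⇒∤ (+-cancelˡ-< L (suc d) 8 (subst (_< L + 8) (sym (+-suc L d)) a<L+8))
    (∣m+n∣m⇒∣n (divides u 8w+1+d≡u*8) (m∣m*n w)))
  where
  8w+1+d≡u*8 : 8 * w + suc d ≡ u * 8
  8w+1+d≡u*8 = sym (+-cancelˡ-≡ L (u * 8) (8 * w + suc d) (trans (cong (L +_) (*-comm u 8)) (trans eq (regroup L d w))))
    where
    regroup : ∀ L d w → suc L + d + 8 * w ≡ L + (8 * w + suc d)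
    regroup = solve-∀

module Leave {n ls cs} (s : Splits (K n) ls (concatMap circuitEdges cs)) where

  size : length ls + 8 * length cs ≡ triangle n
  size = begin
    length ls + 8 * length cs                         ≡⟨ cong (length ls +_) (length-circuits cs) ⟨
    length ls + length (concatMap circuitEdges cs)    ≡⟨ length-++ ls ⟨
    length (ls ++ concatMap circuitEdges cs)          ≡⟨ ↭-length (splits⇒↭ s) ⟩
    length (pairs n)                                  ≡⟨ length-pairs n ⟩
    triangle n                                        ∎
    where open ≡-Reasoning

  degree-parity : ∀ {v} → v < n → ∃[ k ] suc (degree v ls + 2 * k) ≡ n
  degree-parity {v} v<n with k , eq ← degree-circuits v cs = k , (begin
    suc (degree v ls + 2 * k)                                 ≡⟨ cong (λ d → suc (degree v ls + d)) eq ⟨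
    suc (degree v ls + degree v (concatMap circuitEdges cs))  ≡⟨ cong suc (degree-++ v ls _) ⟨
    suc (degree v (ls ++ concatMap circuitEdges cs))          ≡⟨ cong suc (sum-↭ (↭-map⁺ (ends v) (splits⇒↭ s))) ⟩
    suc (degree v (pairs n))                                  ≡⟨ degree-pairs-< n v<n ⟩
    n                                                         ∎)
    where open ≡-Reasoning

-- All degrees in the leave are odd, hence positive, so the leave meets every vertex and the
-- handshake inequality applies.
even-half : ∀ {n ls cs} h → n ≡ 2 * h → Splits (K n) ls (concatMap circuitEdges cs) → h ≤ length ls
even-half {n} {ls} {cs} h refl s = *-cancelˡ-≤ 2 (≤-trans
  (Σ<-lower n (λ v → degree v ls) positive) (handshake n ls))
  where
  positive : ∀ {v} → v < n → 1 ≤ degree v ls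
  positive {v} v<n with degree v ls | Leave.degree-parity {cs = cs} s v<n
  ... | suc _ | _      = s≤s z≤n
  ... | zero  | k , eq = ⊥-elim (even≢odd h k (sym eq))

odd-degree-even : ∀ {n ls cs} h → n ≡ suc (2 * h) → Splits (K n) ls (concatMap circuitEdges cs) →
  ∀ {v} d → v < n → degree v ls ≢ suc (2 * d)
odd-degree-even {cs = cs} h eq s d v<n deg with k , eq′ ← Leave.degree-parity {cs = cs} s v<n =
  even≢odd h (d + k) (suc-injective (trans (sym eq) (trans (sym eq′)
    (cong suc (trans (cong (_+ 2 * k) deg) (cong suc (sym (*-distribˡ-+ 2 d k))))))))

-- In an even graph every vertex of an edge lies on a second edge.
odd-not-1 : ∀ {n ls cs} h → n ≡ suc (2 * h) → Splits (K n) ls (concatMap circuitEdges cs) → length ls ≢ 1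
odd-not-1 {ls = (x , y) ∷ []} {cs} h eq s refl with x<y , y<n ← ls-sound s (Any.here refl) =
  odd-degree-even {cs = cs} h eq s 0 (<-trans x<y y<n)
    (cong (_+ 0) (cong₂ _+_ (indicator-≡ x) (indicator-≢ (<⇒≢ x<y))))

-- Both ends of the first edge must lie on the second, so the two edges coincide, against
-- `ls-unique`.
odd-not-2 : ∀ {n ls cs} h → n ≡ suc (2 * h) → Splits (K n) ls (concatMap circuitEdges cs) → length ls ≢ 2
odd-not-2 {n} {(x , y) ∷ (z , w) ∷ []} {cs} h eq s refl
  with x<y , y<n ← ls-sound s (Any.here refl) | z<w , w<n ← ls-sound s (Any.there (Any.here refl))
     | (xy≢zw ∷ []) ∷ _ ← ls-unique s = same (shared x (<-trans x<y y<n) x-odd) (shared y y<n y-odd)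
  where
  x-odd : ends x (x , y) ≡ 1
  x-odd = cong₂ _+_ (indicator-≡ x) (indicator-≢ (<⇒≢ x<y))
  y-odd : ends y (x , y) ≡ 1
  y-odd = cong₂ _+_ (indicator-≢ (>⇒≢ x<y)) (indicator-≡ y)
  shared : ∀ v → v < n → ends v (x , y) ≡ 1 → v ≡ z ⊎ v ≡ w
  shared v v<n one with v ≟ z | v ≟ w
  ... | yes v≡z | _       = inj₁ v≡z
  ... | no _    | yes v≡w = inj₂ v≡w
  ... | no v≢z  | no v≢w  = ⊥-elim (odd-degree-even {cs = cs} h eq s 0 v<n
    (cong₂ _+_ one (cong (_+ 0) (cong₂ _+_ (indicator-≢ v≢z) (indicator-≢ v≢w)))))
  same : x ≡ z ⊎ x ≡ w → y ≡ z ⊎ y ≡ w → ⊥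
  same (inj₁ refl) (inj₁ refl) = <-irrefl refl x<y
  same (inj₁ refl) (inj₂ refl) = xy≢zw refl
  same (inj₂ refl) (inj₁ refl) = <-asym x<y z<w
  same (inj₂ refl) (inj₂ refl) = <-irrefl refl x<y

-- Lower bounds matching the constructions

LeaveBound : ℕ → ℕ → Set
LeaveBound n ℓ = ∀ ls cs → Splits (K n) ls (concatMap circuitEdges cs) → ℓ ≤ length ls

leave-≡-mod-8 : ∀ {b ℓ j ls cs} q → triangle b ≡ ℓ + 8 * j →
  Splits (K (q * 16 + b)) ls (concatMap circuitEdges cs) → ∃[ w ] length ls + 8 * length cs ≡ ℓ + 8 * w
leave-≡-mod-8 {b} {ℓ} {j} {cs = cs} q eq s with w , eq′ ← triangle-mod-8 q b =
  j + w , trans (Leave.size {cs = cs} s) (trans eq′ (trans (cong (_+ 8 * w) eq) (regroup ℓ j w)))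
  where
  regroup : ∀ ℓ j w → ℓ + 8 * j + 8 * w ≡ ℓ + 8 * (j + w)
  regroup = solve-∀

-- The leave is congruent to `ℓ` modulo 8 and has at least `q * 8 + h` edges. As `ℓ < h + 8`,
-- falling below `q * 8 + ℓ` by a multiple of 8 would break the second condition.
even-bound : ∀ h ℓ j → ℓ < h + 8 → triangle (2 * h) ≡ ℓ + 8 * j →
  ∀ q → LeaveBound (q * 16 + 2 * h) (q * 8 + ℓ)
even-bound h ℓ j ℓ<h+8 eq q ls cs s with w , eq′ ← leave-≡-mod-8 {2 * h} {ℓ} {j} {ls} {cs} q eq s =
  ≤-from-≡-mod-8 (q + length cs) w
    (trans (regroup (length ls) q (length cs)) (trans (cong (q * 8 +_) eq′) (sym (+-assoc (q * 8) ℓ (8 * w)))))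
    (<-≤-trans (+-monoʳ-< (q * 8) ℓ<h+8) (≤-trans (≤-reflexive (sym (+-assoc (q * 8) h 8)))
      (+-monoˡ-≤ 8 (even-half {cs = cs} (q * 8 + h) (halve q h) s))))
  where
  regroup : ∀ L q C → L + 8 * (q + C) ≡ q * 8 + (L + 8 * C)
  regroup = solve-∀
  halve : ∀ q h → q * 16 + 2 * h ≡ 2 * (q * 8 + h)
  halve = solve-∀

residue-bound : ∀ b ℓ j → ℓ < 8 → triangle b ≡ ℓ + 8 * j → ∀ q → LeaveBound (q * 16 + b) ℓ
residue-bound b ℓ j ℓ<8 eq q ls cs s with w , eq′ ← leave-≡-mod-8 {b} {ℓ} {j} {ls} {cs} q eq s =
  ≤-from-≡-mod-8 (length cs) w eq′ (<-≤-trans ℓ<8 (m≤n+m 8 (length ls)))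

-- With the least member `ℓ` of the residue class excluded, the next one is `8 + ℓ`. This serves the
-- residues 1 and 2, which the parity of the degrees rules out as sizes.
next-residue-bound : ∀ b ℓ j → ℓ < 8 → triangle b ≡ 8 + ℓ + 8 * j → ∀ q →
  (∀ ls cs → Splits (K (q * 16 + b)) ls (concatMap circuitEdges cs) → length ls ≢ ℓ) →
  LeaveBound (q * 16 + b) (8 + ℓ)
next-residue-bound b ℓ j ℓ<8 eq q L≢ℓ ls cs s
  with w , eq′ ← leave-≡-mod-8 {b} {8 + ℓ} {j} {ls} {cs} q eq s =
  ≤-from-≡-mod-8 (length cs) w eq′ (≤-trans (s≤s (≤-reflexive (+-comm 8 ℓ)))
    (+-monoˡ-≤ 8 (≤∧≢⇒< (residue-bound b ℓ (suc j) ℓ<8 (trans eq (regroup ℓ j)) q ls cs s) (L≢ℓ ls cs s ∘ sym))))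
  where
  regroup : ∀ ℓ j → 8 + ℓ + 8 * j ≡ ℓ + 8 * suc j
  regroup = solve-∀

halve-odd : ∀ q h → q * 16 + suc (2 * h) ≡ suc (2 * (q * 8 + h))
halve-odd = solve-∀

Optimal : ℕ → Set
Optimal n = ∃[ ℓ ] Decomposition (K n) ℓ × LeaveBound n ℓ

-- The third argument of the bounds is (triangle b − ℓ) / 8.
optimal : All (λ b → ∀ q → Optimal (q * 16 + b)) (applyUpTo (8 +_) 16)
optimal =
    (λ q → _ , extendEven 2 decomposition₈ q , even-bound 4 4 3 (<ᵇ⇒< _ _ _) refl q)
  ∷ (λ q → _ , extendOdd 2 decomposition₉ q , residue-bound 9 4 4 (<ᵇ⇒< _ _ _) refl q)
  ∷ (λ q → _ , extendEven 3 decomposition₁₀ q , even-bound 5 5 5 (<ᵇ⇒< _ _ _) refl q)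
  ∷ (λ q → _ , extendOdd 3 decomposition₁₁ q , residue-bound 11 7 6 (<ᵇ⇒< _ _ _) refl q)
  -- For `q = 0`: 66 edges leave residue 2, but at least 6 edges must remain, so the least size is
  -- 10.
  ∷ (λ q → _ , extendEven 4 decomposition₁₂ q , even-bound 6 10 7 (<ᵇ⇒< _ _ _) refl q)
  ∷ (λ q → _ , extendOdd 4 decomposition₁₃ q , residue-bound 13 6 9 (<ᵇ⇒< _ _ _) refl q)
  ∷ (λ q → _ , extendEven 5 decomposition₁₄ q , even-bound 7 11 10 (<ᵇ⇒< _ _ _) refl q)
  ∷ (λ q → _ , extendOdd 5 decomposition₁₅ q , next-residue-bound 15 1 12 (<ᵇ⇒< _ _ _) refl q
      (λ ls cs → odd-not-1 {cs = cs} (q * 8 + 7) (halve-odd q 7)))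
  ∷ (λ q → _ , extendEven 6 decomposition₁₆ q , even-bound 8 8 14 (<ᵇ⇒< _ _ _) refl q)
  ∷ (λ q → _ , extendOdd 6 decomposition₁₇ q , λ _ _ _ → z≤n)
  ∷ (λ q → _ , extendEven 7 decomposition₁₈ q , even-bound 9 9 18 (<ᵇ⇒< _ _ _) refl q)
  ∷ (λ q → _ , extendOdd 7 decomposition₁₉ q , residue-bound 19 3 21 (<ᵇ⇒< _ _ _) refl q)
  ∷ (λ q → _ , extendEven 8 decomposition₂₀ q , even-bound 10 14 22 (<ᵇ⇒< _ _ _) refl q)
  ∷ (λ q → _ , extendOdd 8 decomposition₂₁ q , next-residue-bound 21 2 25 (<ᵇ⇒< _ _ _) refl q
      (λ ls cs → odd-not-2 {cs = cs} (q * 8 + 10) (halve-odd q 10)))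
  ∷ (λ q → _ , extendEven 9 decomposition₂₂ q , even-bound 11 15 27 (<ᵇ⇒< _ _ _) refl q)
  ∷ (λ q → _ , extendOdd 9 decomposition₂₃ q , residue-bound 23 5 31 (<ᵇ⇒< _ _ _) refl q)
  ∷ []

optimal-≥8 : ∀ {n} → 8 ≤ n → Optimal n
optimal-≥8 8≤n with j , refl ← m≤n⇒∃[o]m+o≡n 8≤n = subst Optimal eq
  -- Dividing `n − 8`, rather than `n`, by 16 puts the base order between 8 and 23.
  (All.applyUpTo⁻ (8 +_) 16 optimal (m%n<n j 16) (j / 16))
  where
  eq : j / 16 * 16 + (8 + j % 16) ≡ 8 + j
  eq = trans (+-comm (j / 16 * 16) (8 + j % 16)) (cong (8 +_) (sym (m≡m%n+[m/n]*n j 16)))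

optimal⇒maximum : ∀ {n} → Optimal n → Σ (Packing n) (λ P → IsMaximum P × AlmostTwoPerfect P)
optimal⇒maximum {n} (ℓ , D , bound) with P , a2p , size ← realise D = P , maximum , a2p
  where
  maximum : IsMaximum P
  maximum Q = begin
    length (Packing.leave P)              ≡⟨ size ⟩
    ℓ                                     ≤⟨ bound _ (map circuit (Packing.cycles Q))
                                               (subst (Splits (K n) _)
                                                 (sym (concatMap-map circuitEdges circuit (Packing.cycles Q)))
                                                 (packing⇒splits (Packing.isPacking Q))) ⟩
    length (map pair (Packing.leave Q))   ≡⟨ length-map pair (Packing.leave Q) ⟩
    length (Packing.leave Q)              ∎
    where open ≤-Reasoning

mainTheorem1 : (n : ℕ) → 8 ≤ n → Σ (Packing n) (λ P → IsMaximum P × AlmostTwoPerfect P)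
mainTheorem1 n 8≤n = optimal⇒maximum (optimal-≥8 8≤n)
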